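{- Let $v,k,t$ be integers with $v>k>t\ge 2$. Let $X$ be a $v$-set and let $X=X_1\cup X_2$ be a partition of $X$ with $|X_1|=v_1$ and $|X_2|=v_2$. For $i=0,\dots,t$ let $D_i=(X_1,\mathfrak B^{(i)})$ be the complete $i$-$(v_1,i,1)$ design (all $i$-subsets of $X_1$), and for $i=t+1,\dots,k$ let $D_i=(X_1,\mathfrak B^{(i)})$ be a simple $t$-$(v_1,i,\lambda^{(i)}_t)$ design. Similarly, for $i=0,\dots,t$ let $\bar D_i=(X_2,\bar{\mathfrak B}^{(i)})$ be the complete $i$-$(v_2,i,1)$ design, and for $i=t+1,\dots,k$ let $\bar D_i=(X_2,\bar{\mathfrak B}^{(i)})$ be a simple $t$-$(v_2,i,\bar\lambda^{(i)}_t)$ design. Let $K=\{(0,k),(1,k-1),\dots,(k-1,1),(k,0)\}$. Suppose there is a subset $R\subseteq K$ such that for each $(i,k-i)\in R$ the block set of $D_i$ is partitioned into $N_i$ classes $\mathfrak A^{(i)}_1,\dots,\mathfrak A^{(i)}_{N_i}$, each $(X_1,\mathfrak A^{(i)}_h)$ being an $s_i$-$(v_1,i,\lambda^{*(i)}_{s_i})$ design (same index for all $h$), with $s_i<t$, and the block set of $\bar D_{k-i}$ is partitioned into $\bar N_{k-i}$ classes $\bar{\mathfrak A}^{(k-i)}_1,\dots,\bar{\mathfrak A}^{(k-i)}_{\bar N_{k-i}}$, each $(X_2,\bar{\mathfrak A}^{(k-i)}_j)$ being an $s_{k-i}$-$(v_2,k-i,\bar\lambda^{*(k-i)}_{s_{k-i}})$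 design (same index for all $j$), with $s_{k-i}<t$, such that (i) $N_i=\bar N_{k-i}$, and (ii) $s_i+s_{k-i}\ge 2\lfloor t/2\rfloor$. For each $(i,k-i)\in R$ choose $\varepsilon_i\in\{0,1\}$ and an integer $w_i$ with $\varepsilon_i\le w_i\le\lfloor N_i/2\rfloor$, and set $$\mathfrak B^*_{(i,k-i)}=\{B_i\cup\bar B_{k-i}:\ B_i\in\mathfrak A^{(i)}_h,\ \bar B_{k-i}\in\bar{\mathfrak A}^{(k-i)}_j,\ \varepsilon_i\le d(h,j)\le w_i\},$$ where $d(h,j)=\min\{|h-j|,\,N_i-|h-j|\}$ for $h,j\in\{1,\dots,N_i\}$; and put $z_i=2w_i+1-\varepsilon_i$ if $w_i<N_i/2$, and $z_i=2w_i-\varepsilon_i$ if $w_i=N_i/2$. For each $(i,k-i)\in K\setminus R$ set $$\mathfrak B_{(i,k-i)}=\{B_i\cup\bar B_{k-i}:\ B_i\in\mathfrak B^{(i)},\ \bar B_{k-i}\in\bar{\mathfrak B}^{(k-i)}\}.$$ Choose $u_i\in\{0,1\}$ for $i=0,\dots,k$ and define $$\mathfrak B=\bigcup_{(i,k-i)\in R}\mathfrak B^*_{(i,k-i)}\times[u_i]\ \cup\bigcup_{(i,k-i)\in K\setminus R}\mathfrak B_{(i,k-i)}\times[u_i].$$ For $r=0,\dots,t$ define $$L_{r,t-r}=\sum_{(i,k-i)\in R}u_i\,\Lambda^{*(i,k-i)}_{(r,t-r)}+\sum_{(i,k-i)\in K\setminus R}u_i\,\lambda^{(i)}_r\,\bar\lambda^{(k-i)}_{t-r},$$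 where $$\Lambda^{*(i,k-i)}_{(r,t-r)}=\begin{cases}\lambda^{*(i)}_r\,\bar\lambda^{*(k-i)}_{t-r}\,N_i\,z_i & \text{if } r\le s_i,\ t-r\le s_{k-i},\\ \lambda^{*(i)}_r\,\bar\lambda^{(k-i)}_{t-r}\,z_i & \text{if } r\le s_i,\ t-r>s_{k-i},\\ \lambda^{(i)}_r\,\bar\lambda^{*(k-i)}_{t-r}\,z_i & \text{if } r>s_i,\ t-r\le s_{k-i}.\end{cases}$$ If $L_{0,t}=L_{1,t-1}=\dots=L_{t,0}=\Lambda$ for some positive integer $\Lambda$, then $(X,\mathfrak B)$ is a simple $t$-$(v,k,\Lambda)$ design.
   Context: A $t$-$(v,k,\lambda)$ design is a pair $(X,\mathfrak B)$ with $|X|=v$ and $\mathfrak B$ a collection of $k$-subsets (blocks) of $X$ such that every $t$-subset of $X$ lies in exactly $\lambda$ blocks; it is simple if no block is repeated. A $t$-$(v,k,\lambda)$ design is also an $s$-$(v,k,\lambda_s)$ design for $0\le s\le t$ with $\lambda_s=\lambda\binom{v-s}{t-s}/\binom{k-s}{t-s}$. Conventions: the $0$-$(v_1,0,1)$ design has exactly one block, the empty set; a design with $k$ equal to the number of points has the single block consisting of all points. Notation: $\lambda^{(i)}_r$ denotes the number of blocks of $D_i$ containing a given $r$-subset of $X_1$ (for $0\le r\le t$; it is $0$ when $r>i$), and $\bar\lambda^{(i)}_r$ the analogous number for $\bar D_i$ and $X_2$. For $r\le s_i$, $\lambda^{*(i)}_r$ denotes the number of blocks of a class $\mathfrak A^{(i)}_h$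 containing a given $r$-subset of $X_1$ (independent of $h$ and of the subset), and $\bar\lambda^{*(k-i)}_r$ (for $r\le s_{k-i}$) the analogous number for classes $\bar{\mathfrak A}^{(k-i)}_j$. For a set $Y$ and $u\in\{0,1\}$, $Y\times[0]=\emptyset$ and $Y\times[1]=Y$. -}

module Defs where

open import Data.Nat using (ℕ; zero; suc; _+_; _*_; _∸_; _⊓_; _≤_; _<_; _≤ᵇ_; _<ᵇ_; _≤?_; ∣_-_∣; ⌊_/2⌋)
open import Data.Bool using (if_then_else_)
open import Data.Fin using (Fin; zero; suc; toℕ)
open import Data.Fin.Subset using (Subset; inside; outside; _∈_; _⊆_; _∪_; _∩_; ⊤; ⊥; ∣_∣)
open import Data.Fin.Subset.Properties using (_∈?_; _⊆?_)
open import Data.List using (List; []; _++_; length; map; filter; concat; concatMap; tabulate; allFin; cartesianProduct; cartesianProductWith)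
open import Data.Nat.ListAction using (sum)
import Data.List.Membership.Propositional as List
open import Data.List.Relation.Unary.Unique.Propositional using (Unique)
open import Data.List.Relation.Binary.Permutation.Propositional using (_↭_)
open import Data.Product using (_×_; _,_)
open import Data.Vec using ([]; _∷_)
open import Function.Bundles using (_⇔_)
open import Relation.Binary.PropositionalEquality using (_≡_)
open import Relation.Nullary using (¬?)
open import Relation.Nullary.Decidable using (_×-dec_)

-- Point sets are subsets Y of an ambient set Fin n.  A collection of blocks is
-- a list, so that blocks may be repeated; simplicity is the predicate Unique.
Blocks : ℕ → Set
Blocks n = List (Subset n)

degree : ∀ {n} → Subset n → Blocks n → ℕ
degree S 𝔅 = length (filter (S ⊆?_) 𝔅)

-- (Y , 𝔅) is a t-(v,k,μ) design.  The inequality t ≤ k is implicit in the usual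
-- formula λ_s = λ C(v-s,t-s) / C(k-s,t-s).  There is no requirement k ≤ v: for
-- k > v the collection of blocks is empty.
record IsDesign {n} (Y : Subset n) (𝔅 : Blocks n) (t v k μ : ℕ) : Set where
  field
    order     : ∣ Y ∣ ≡ v
    strength  : t ≤ k
    onPoints  : ∀ {B} → B List.∈ 𝔅 → B ⊆ Y
    blockSize : ∀ {B} → B List.∈ 𝔅 → ∣ B ∣ ≡ k
    balanced  : ∀ T → T ⊆ Y → ∣ T ∣ ≡ t → degree T 𝔅 ≡ μ

IsSimpleDesign : ∀ {n} → Subset n → Blocks n → (t v k μ : ℕ) → Set
IsSimpleDesign Y 𝔅 t v k μ = IsDesign Y 𝔅 t v k μ × Unique 𝔅

IsComplete : ∀ {n} → Subset n → Blocks n → ℕ → Set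
IsComplete Y 𝔅 i = Unique 𝔅 × (∀ B → B List.∈ 𝔅 ⇔ (B ⊆ Y × ∣ B ∣ ≡ i))

firstPoints : ∀ {n} → ℕ → Subset n → Subset n
firstPoints r       []            = []
firstPoints zero    (_ ∷ Y)       = outside ∷ firstPoints zero Y
firstPoints (suc r) (inside ∷ Y)  = inside ∷ firstPoints r Y
firstPoints (suc r) (outside ∷ Y) = outside ∷ firstPoints (suc r) Y

-- λ_r: the number of blocks containing a given r-subset of Y.  In a t-design it
-- is the same for all r-subsets when r ≤ t, so it is read off at the r-subset
-- formed by the first r points of Y.  If r > ∣ Y ∣ there are neither r-subsets
-- nor blocks of size at least r, and λ_r = 0.
lam : ∀ {n} → Subset n → Blocks n → ℕ → ℕ
lam Y 𝔅 r = if r ≤ᵇ ∣ Y ∣ then degree (firstPoints r Y) 𝔅 else 0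

-- λ*_r, read off from the first class, since it does not depend on the class.
lam* : ∀ {n N} → Subset n → (Fin N → Blocks n) → ℕ → ℕ
lam* {N = zero}  Y 𝔄 r = 0
lam* {N = suc _} Y 𝔄 r = lam Y (𝔄 zero) r

IsPartitionOf : ∀ {n N} → (Fin N → Blocks n) → Blocks n → Set
IsPartitionOf 𝔄 𝔅 = concat (tabulate 𝔄) ↭ 𝔅

join : ∀ {n} → Blocks n → Blocks n → Blocks n
join = cartesianProductWith _∪_

infix 8 _×[_]
_×[_] : ∀ {n} → Blocks n → Fin 2 → Blocks n
𝔅 ×[ zero ]     = []
𝔅 ×[ suc zero ] = 𝔅

-- Only differences of class labels occur, so labels 0,…,N-1 serve as well as
-- 1,…,N.
dist : ℕ → ℕ → ℕ → ℕ
dist N h j = ∣ h - j ∣ ⊓ (N ∸ ∣ h - j ∣)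

-- The data entering the construction.  The index i : Fin (suc k) stands for the
-- pair (i , k - i), so K is Fin (suc k).  The fields N₂, 𝔄₂, s₂ at i belong to
-- the second member of that pair: they are N̄_{k-i}, 𝔄̄^{(k-i)} and s_{k-i}.
-- Values at i ∉ R of N, 𝔄, s, ε, w, and D₁, D₂ beyond k, are never used.
record Data (v k : ℕ) : Set where
  field
    X₁ X₂ : Subset v
    D₁ D₂ : ℕ → Blocks v
    R     : Subset (suc k)
    N₁ N₂ : Fin (suc k) → ℕ
    𝔄₁    : ∀ i → Fin (N₁ i) → Blocks v
    𝔄₂    : ∀ i → Fin (N₂ i) → Blocks v
    s₁ s₂ : Fin (suc k) → ℕ
    ε     : Fin (suc k) → Fin 2
    w     : Fin (suc k) → ℕ
    u     : Fin (suc k) → Fin 2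

  co : Fin (suc k) → ℕ
  co i = k ∸ toℕ i

  inR outsideR : List (Fin (suc k))
  inR      = filter (_∈? R) (allFin (suc k))
  outsideR = filter (λ i → ¬? (i ∈? R)) (allFin (suc k))

  𝔅* : Fin (suc k) → Blocks v
  𝔅* i = concatMap (λ (h , j) → join (𝔄₁ i h) (𝔄₂ i j))
           (filter (λ (h , j) → (toℕ (ε i) ≤? d h j) ×-dec (d h j ≤? w i))
             (cartesianProduct (allFin (N₁ i)) (allFin (N₂ i))))
    where
    d : Fin (N₁ i) → Fin (N₂ i) → ℕ
    d h j = dist (N₁ i) (toℕ h) (toℕ j)

  -- The full join, written 𝔅_{(i,k-i)} without star for i ∉ R.
  𝔅ᶠ : Fin (suc k) → Blocks v
  𝔅ᶠ i = join (D₁ (toℕ i)) (D₂ (co i))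

  -- Unions are formed by concatenating lists, i.e. with multiplicities, so that
  -- simplicity of 𝔅 is a genuine assertion.
  𝔅 : Blocks v
  𝔅 = concatMap (λ i → 𝔅* i ×[ u i ]) inR ++ concatMap (λ i → 𝔅ᶠ i ×[ u i ]) outsideR

  z : Fin (suc k) → ℕ
  z i = if 2 * w i <ᵇ N₁ i then 2 * w i + 1 ∸ toℕ (ε i) else 2 * w i ∸ toℕ (ε i)

  λ₁ λ₂ λ*₁ λ*₂ : Fin (suc k) → ℕ → ℕ
  λ₁ i  = lam X₁ (D₁ (toℕ i))
  λ₂ i  = lam X₂ (D₂ (co i))
  λ*₁ i = lam* X₁ (𝔄₁ i)
  λ*₂ i = lam* X₂ (𝔄₂ i)

  -- The last case, r > s₁ i and r′ > s₂ i, cannot occur when r + r′ = t, because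
  -- s₁ i + s₂ i ≥ 2 ⌊t/2⌋.
  Λ* : Fin (suc k) → ℕ → ℕ → ℕ
  Λ* i r r′ =
    if r ≤ᵇ s₁ i
    then (if r′ ≤ᵇ s₂ i
          then λ*₁ i r * λ*₂ i r′ * N₁ i * z i
          else λ*₁ i r * λ₂ i r′ * z i)
    else (if r′ ≤ᵇ s₂ i
          then λ₁ i r * λ*₂ i r′ * z i
          else 0)

  L : ℕ → ℕ → ℕ
  L r r′ = sum (map (λ i → toℕ (u i) * Λ* i r r′) inR)
         + sum (map (λ i → toℕ (u i) * (λ₁ i r * λ₂ i r′)) outsideR)

record Hypotheses {v k} (C : Data v k) (t v₁ v₂ : ℕ) : Set where
  open Data C
  field
    cover    : X₁ ∪ X₂ ≡ ⊤
    disjoint : X₁ ∩ X₂ ≡ ⊥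
    size₁    : ∣ X₁ ∣ ≡ v₁
    size₂    : ∣ X₂ ∣ ≡ v₂

    complete₁ : ∀ i → i ≤ t → IsComplete X₁ (D₁ i) i
    complete₂ : ∀ i → i ≤ t → IsComplete X₂ (D₂ i) i
    design₁   : ∀ i → t < i → i ≤ k → IsSimpleDesign X₁ (D₁ i) t v₁ i (lam X₁ (D₁ i) t)
    design₂   : ∀ i → t < i → i ≤ k → IsSimpleDesign X₂ (D₂ i) t v₂ i (lam X₂ (D₂ i) t)

    partition₁ : ∀ i → i ∈ R → IsPartitionOf (𝔄₁ i) (D₁ (toℕ i))
    partition₂ : ∀ i → i ∈ R → IsPartitionOf (𝔄₂ i) (D₂ (co i))
    class₁     : ∀ i → i ∈ R → ∀ h → IsDesign X₁ (𝔄₁ i h) (s₁ i) v₁ (toℕ i) (λ*₁ i (s₁ i))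
    class₂     : ∀ i → i ∈ R → ∀ j → IsDesign X₂ (𝔄₂ i j) (s₂ i) v₂ (co i) (λ*₂ i (s₂ i))
    s₁<t       : ∀ i → i ∈ R → s₁ i < t
    s₂<t       : ∀ i → i ∈ R → s₂ i < t
    sameNumber : ∀ i → i ∈ R → N₁ i ≡ N₂ i
    strengths  : ∀ i → i ∈ R → 2 * ⌊ t /2⌋ ≤ s₁ i + s₂ i

    ε≤w   : ∀ i → i ∈ R → toℕ (ε i) ≤ w i
    w≤N/2 : ∀ i → i ∈ R → w i ≤ ⌊ N₁ i /2⌋

{-# OPTIONS --safe #-}
-- A t-subset T of X meets X₁ in r and X₂ in t − r points, and it lies in B₁ ∪ B₂ iff T ∩ X₁ ⊆ B₁ and
-- T ∩ X₂ ⊆ B₂.  So a full join contributes λ_r λ̄_{t-r} to the degree of T.  In a starred join the pairs of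
-- classes (h , j) are weighted by the indicator of ε ≤ d(h,j) ≤ w, a circulant matrix all of whose row and
-- column sums are z.  As s_i + s_{k-i} ≥ 2⌊t/2⌋, at least one of r ≤ s_i and t − r ≤ s_{k-i} holds, so in one of
-- the two factors the degree does not depend on the class and can be pulled out of the sum.  The blocks are
-- distinct because B determines B ∩ X₁ and B ∩ X₂, hence i = |B ∩ X₁| and the classes.
module Submission where

open import Defs
open import Data.Nat using (ℕ; zero; suc; _+_; _*_; _∸_; _⊓_; _/_; _≤_; _<_; _>_; _≥_; _≤ᵇ_; _<ᵇ_; _≤?_; _<?_; _≤′_; ≤′-refl; ≤′-step; z≤n; s≤s; z<s; s<s; ∣_-_∣; ⌊_/2⌋)
open import Data.Nat.Properties
open import Data.Nat.DivMod using (m*n/n≡m)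
open import Data.Nat.ListAction using (sum)
open import Data.Nat.ListAction.Properties using (sum-++; sum-↭)
open import Data.Bool using (true; false; if_then_else_; T)
open import Data.Fin using (Fin; zero; suc; toℕ)
open import Data.Fin.Properties using (toℕ<n; toℕ-injective)
open import Data.Fin.Subset using (Subset; inside; outside; _∈_; _∉_; _⊆_; _∪_; _∩_; ⊤; ⁅_⁆; ∣_∣)
open import Data.Fin.Subset.Properties
open import Data.List using (List; []; _∷_; _++_; length; map; filter; concat; concatMap; tabulate; allFin; cartesianProduct; cartesianProductWith; applyUpTo)
open import Data.List.Properties using (map-∘; map-++; map-cong-local; map-tabulate; length-tabulate; applyUpTo-∷ʳ)
import Data.List.Membership.Propositional as List
open import Data.List.Membership.Propositional.Properties
open import Data.List.Relation.Unary.All as All using ([]; _∷_)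
open import Data.List.Relation.Unary.Any using (here; there; satisfied)
open import Data.List.Relation.Unary.AllPairs using ([]; _∷_)
open import Data.List.Relation.Unary.Unique.Propositional using (Unique)
import Data.List.Relation.Unary.Unique.Propositional.Properties as Unique
open import Data.List.Relation.Binary.Permutation.Propositional using (_↭_; ↭-sym; ↭⇒↭ₛ)
open import Data.List.Relation.Binary.Permutation.Propositional.Properties using (map⁺; ∈-resp-↭)
import Data.List.Relation.Binary.Permutation.Setoid.Properties as ↭ₛ
open import Data.Product using (_×_; _,_; proj₁; proj₂; ∃)
open import Data.Sum using ([_,_]′)
open import Data.Vec using ([]; _∷_)
open import Function using (_∘_; id; Equivalence)
open import Relation.Nullary using (Dec; yes; no; does; ¬_; ¬?; contradiction)
open import Relation.Nullary.Decidable using (_×-dec_)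
open import Relation.Unary using (Pred; Decidable)
open import Relation.Binary.PropositionalEquality using (_≡_; refl; sym; trans; cong; cong₂; subst; setoid; module ≡-Reasoning)

-- A degree is handled as the sum of the indicators `𝟙 (S ⊆? B)` over the list of blocks, so
-- repetitions are counted correctly and double counting becomes an exchange of sums. Two points
-- need care. λ_r is a number read off at one chosen r-subset, and λ*_r moreover in one chosen
-- class; independence of both choices comes from lowering the strength of a design one step at a
-- time, with an index computed from the parameters alone. Also, the strengths do not cover every r
-- ≤ t. The complete D_i with i < t is only an i-design, and its degrees for larger r are zero. A
-- class of strength s_i < r has degrees that may vary, but their sum over all classes is a degree
-- in D_i.

private variable
  A B C : Set
  P Q : Set
  n N N′ : ℕ

-- Finite sums and counting

∑ : List A → (A → ℕ) → ℕ
∑ xs f = sum (map f xs)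

𝟙 : Dec P → ℕ
𝟙 P? = if does P? then 1 else 0

∑-cong : ∀ {xs : List A} {f g} → (∀ {x} → x List.∈ xs → f x ≡ g x) → ∑ xs f ≡ ∑ xs g
∑-cong {xs = []}    f≡g = refl
∑-cong {xs = _ ∷ _} f≡g = cong₂ _+_ (f≡g (here refl)) (∑-cong (f≡g ∘ there))

∑-+ : ∀ (xs : List A) f g → ∑ xs (λ x → f x + g x) ≡ ∑ xs f + ∑ xs g
∑-+ []       f g = refl
∑-+ (x ∷ xs) f g = begin
  f x + g x + ∑ xs (λ x → f x + g x)  ≡⟨ cong (f x + g x +_) (∑-+ xs f g) ⟩
  f x + g x + (∑ xs f + ∑ xs g)       ≡⟨ +-assoc (f x) (g x) _ ⟩
  f x + (g x + (∑ xs f + ∑ xs g))     ≡⟨ cong (f x +_) (x∙yz≈y∙xz (g x) (∑ xs f) _) ⟩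
  f x + (∑ xs f + (g x + ∑ xs g))     ≡⟨ +-assoc (f x) (∑ xs f) _ ⟨
  f x + ∑ xs f + (g x + ∑ xs g)       ∎
  where
  open ≡-Reasoning
  open import Algebra.Properties.CommutativeSemigroup +-commutativeSemigroup using (x∙yz≈y∙xz)

∑-*ˡ : ∀ (xs : List A) c f → ∑ xs (λ x → c * f x) ≡ c * ∑ xs f
∑-*ˡ []       c f = sym (*-zeroʳ c)
∑-*ˡ (x ∷ xs) c f = trans (cong (c * f x +_) (∑-*ˡ xs c f)) (sym (*-distribˡ-+ c (f x) _))

∑-*ʳ : ∀ (xs : List A) c f → ∑ xs (λ x → f x * c) ≡ ∑ xs f * c
∑-*ʳ []       c f = refl
∑-*ʳ (x ∷ xs) c f = trans (cong (f x * c +_) (∑-*ʳ xs c f)) (sym (*-distribʳ-+ c (f x) _))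

∑-const : ∀ (xs : List A) c → ∑ xs (λ _ → c) ≡ length xs * c
∑-const []       c = refl
∑-const (_ ∷ xs) c = cong (c +_) (∑-const xs c)

∑-swap : ∀ (xs : List A) (ys : List B) (f : A → B → ℕ) →
         ∑ xs (λ x → ∑ ys (f x)) ≡ ∑ ys (λ y → ∑ xs (λ x → f x y))
∑-swap []       ys f = sym (trans (∑-const ys 0) (*-zeroʳ (length ys)))
∑-swap (x ∷ xs) ys f = trans (cong (∑ ys (f x) +_) (∑-swap xs ys f)) (sym (∑-+ ys (f x) _))

∑-++ : ∀ (xs ys : List A) f → ∑ (xs ++ ys) f ≡ ∑ xs f + ∑ ys f
∑-++ []       ys f = refl
∑-++ (x ∷ xs) ys f = trans (cong (f x +_) (∑-++ xs ys f)) (sym (+-assoc (f x) _ _))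

∑-concatMap : ∀ (g : A → List B) xs f → ∑ (concatMap g xs) f ≡ ∑ xs (λ x → ∑ (g x) f)
∑-concatMap g []       f = refl
∑-concatMap g (x ∷ xs) f = trans (∑-++ (g x) _ f) (cong (∑ (g x) f +_) (∑-concatMap g xs f))

∑-cartesianProductWith : ∀ (g : A → B → C) xs ys f →
                         ∑ (cartesianProductWith g xs ys) f ≡ ∑ xs (λ x → ∑ ys (λ y → f (g x y)))
∑-cartesianProductWith g []       ys f = refl
∑-cartesianProductWith g (x ∷ xs) ys f =
  trans (∑-++ (map (g x) ys) _ f)
        (cong₂ _+_ (cong sum (sym (map-∘ ys))) (∑-cartesianProductWith g xs ys f))

∑-filter : ∀ {P : Pred A _} (P? : Decidable P) xs f →
           ∑ (filter P? xs) f ≡ ∑ xs (λ x → 𝟙 (P? x) * f x)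
∑-filter P? []       f = refl
∑-filter P? (x ∷ xs) f with does (P? x)
... | true  = cong₂ _+_ (sym (+-identityʳ (f x))) (∑-filter P? xs f)
... | false = ∑-filter P? xs f

length-filter≡∑ : ∀ {P : Pred A _} (P? : Decidable P) xs → length (filter P? xs) ≡ ∑ xs (λ x → 𝟙 (P? x))
length-filter≡∑ P? []       = refl
length-filter≡∑ P? (x ∷ xs) with does (P? x)
... | true  = cong suc (length-filter≡∑ P? xs)
... | false = length-filter≡∑ P? xs

𝟙-yes : (P? : Dec P) → P → 𝟙 P? ≡ 1
𝟙-yes (yes _) p = refl
𝟙-yes (no ¬p) p = contradiction p ¬p

𝟙-no : (P? : Dec P) → ¬ P → 𝟙 P? ≡ 0
𝟙-no (yes p) ¬p = contradiction p ¬p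
𝟙-no (no _)  ¬p = refl

𝟙-cong : (P? : Dec P) (Q? : Dec Q) → (P → Q) → (Q → P) → 𝟙 P? ≡ 𝟙 Q?
𝟙-cong P? (yes q) f g = 𝟙-yes P? (g q)
𝟙-cong P? (no ¬q) f g = 𝟙-no P? (¬q ∘ f)

𝟙-× : (P? : Dec P) (Q? : Dec Q) → 𝟙 (P? ×-dec Q?) ≡ 𝟙 P? * 𝟙 Q?
𝟙-× (yes _) (yes _) = refl
𝟙-× (yes _) (no _)  = refl
𝟙-× (no _)  _       = refl

𝟙-*-cong : ∀ (P? : Dec P) {a b} → (P → a ≡ b) → 𝟙 P? * a ≡ 𝟙 P? * b
𝟙-*-cong (yes p) a≡b = cong (1 *_) (a≡b p)
𝟙-*-cong (no _)  a≡b = refl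

∣p∣≡∑ : (p : Subset n) → ∣ p ∣ ≡ ∑ (allFin n) (λ x → 𝟙 (x ∈? p))
∣p∣≡∑ []      = refl
∣p∣≡∑ (b ∷ p) = begin
  ∣ b ∷ p ∣                                             ≡⟨ head-count b ⟩
  𝟙 (zero ∈? b ∷ p) + ∣ p ∣                             ≡⟨ cong (𝟙 (zero ∈? b ∷ p) +_) (∣p∣≡∑ p) ⟩
  𝟙 (zero ∈? b ∷ p) + ∑ (tabulate id) (λ x → 𝟙 (x ∈? p)) ≡⟨ cong (λ xs → 𝟙 (zero ∈? b ∷ p) + sum xs) tail-sum ⟩
  ∑ (allFin _) (λ x → 𝟙 (x ∈? b ∷ p))                   ∎
  where
  open ≡-Reasoning
  head-count : ∀ b → ∣ b ∷ p ∣ ≡ 𝟙 (zero ∈? b ∷ p) + ∣ p ∣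
  head-count inside  = refl
  head-count outside = refl
  tail-sum : map (λ x → 𝟙 (x ∈? p)) (tabulate id) ≡ map (λ x → 𝟙 (x ∈? b ∷ p)) (tabulate suc)
  tail-sum = trans (map-tabulate id _) (sym (map-tabulate suc _))

-- Both sides of the double count in `degree-step` end here: q is a block around S on one side and
-- the whole point set Y on the other.
∑-∖ : {p q : Subset n} → p ⊆ q →
      ∑ (allFin n) (λ x → 𝟙 ((x ∈? q) ×-dec ¬? (x ∈? p))) ≡ ∣ q ∣ ∸ ∣ p ∣
∑-∖ {n = n} {p} {q} p⊆q = begin
  ∑ (allFin n) q∖p                            ≡⟨ m+n∸m≡n ∣ p ∣ _ ⟨
  ∣ p ∣ + ∑ (allFin n) q∖p ∸ ∣ p ∣            ≡⟨ cong (λ m → m + ∑ (allFin n) q∖p ∸ ∣ p ∣) (∣p∣≡∑ p) ⟩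
  ∑ (allFin n) (λ x → 𝟙 (x ∈? p)) + ∑ (allFin n) q∖p ∸ ∣ p ∣
                                              ≡⟨ cong (_∸ ∣ p ∣) (∑-+ (allFin n) _ q∖p) ⟨
  ∑ (allFin n) (λ x → 𝟙 (x ∈? p) + q∖p x) ∸ ∣ p ∣
                                              ≡⟨ cong (_∸ ∣ p ∣) (∑-cong {xs = allFin n} (λ {x} _ → split x)) ⟩
  ∑ (allFin n) (λ x → 𝟙 (x ∈? q)) ∸ ∣ p ∣     ≡⟨ cong (_∸ ∣ p ∣) (∣p∣≡∑ q) ⟨
  ∣ q ∣ ∸ ∣ p ∣                               ∎
  where
  open ≡-Reasoning
  q∖p : Fin n → ℕ
  q∖p x = 𝟙 ((x ∈? q) ×-dec ¬? (x ∈? p))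
  split : ∀ x → 𝟙 (x ∈? p) + q∖p x ≡ 𝟙 (x ∈? q)
  split x with x ∈? p | x ∈? q
  ... | yes _   | yes _   = refl
  ... | yes x∈p | no  x∉q = contradiction (p⊆q x∈p) x∉q
  ... | no  _   | yes _   = refl
  ... | no  _   | no  _   = refl

∣p∪q∣≡∣p∣+∣q∣ : {p q : Subset n} → (∀ {x} → x ∈ p → x ∉ q) → ∣ p ∪ q ∣ ≡ ∣ p ∣ + ∣ q ∣
∣p∪q∣≡∣p∣+∣q∣ {n = n} {p} {q} p#q = begin
  ∣ p ∪ q ∣                                              ≡⟨ ∣p∣≡∑ (p ∪ q) ⟩
  ∑ (allFin n) (λ x → 𝟙 (x ∈? p ∪ q))                    ≡⟨ ∑-cong {xs = allFin n} (λ {x} _ → split x) ⟩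
  ∑ (allFin n) (λ x → 𝟙 (x ∈? p) + 𝟙 (x ∈? q))           ≡⟨ ∑-+ (allFin n) _ _ ⟩
  ∑ (allFin n) (λ x → 𝟙 (x ∈? p)) + ∑ (allFin n) (λ x → 𝟙 (x ∈? q))
                                                         ≡⟨ cong₂ _+_ (∣p∣≡∑ p) (∣p∣≡∑ q) ⟨
  ∣ p ∣ + ∣ q ∣                                          ∎
  where
  open ≡-Reasoning
  split : ∀ x → 𝟙 (x ∈? p ∪ q) ≡ 𝟙 (x ∈? p) + 𝟙 (x ∈? q)
  split x with x ∈? p | x ∈? q
  ... | yes x∈p | yes x∈q = contradiction x∈q (p#q x∈p)
  ... | yes x∈p | no  _   = 𝟙-yes (x ∈? p ∪ q) (p⊆p∪q q x∈p)
  ... | no  _   | yes x∈q = 𝟙-yes (x ∈? p ∪ q) (q⊆p∪q p q x∈q)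
  ... | no  x∉p | no  x∉q = 𝟙-no (x ∈? p ∪ q) ([ x∉p , x∉q ]′ ∘ x∈p∪q⁻ p q)

∪-least : {p q r : Subset n} → p ⊆ r → q ⊆ r → p ∪ q ⊆ r
∪-least {p = p} {q} p⊆r q⊆r = [ p⊆r , q⊆r ]′ ∘ x∈p∪q⁻ p q

-- Degrees in designs

degree≡∑ : ∀ (S : Subset n) 𝔅 → degree S 𝔅 ≡ ∑ 𝔅 (λ B → 𝟙 (S ⊆? B))
degree≡∑ S = length-filter≡∑ (S ⊆?_)

module _ {Y S : Subset n} {𝔅 : Blocks n} {v k r μ : ℕ} where
  open ≡-Reasoning

  -- Counts the pairs (x , B) with x ∈ Y ∖ S and S ∪ {x} ⊆ B ∈ 𝔅 in two ways.
  degree-step : IsDesign Y 𝔅 (suc r) v k μ → S ⊆ Y → ∣ S ∣ ≡ r → degree S 𝔅 * (k ∸ r) ≡ μ * (v ∸ r)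
  degree-step D S⊆Y ∣S∣≡r = begin
    degree S 𝔅 * (k ∸ r)                                   ≡⟨ cong (_* (k ∸ r)) (degree≡∑ S 𝔅) ⟩
    ∑ 𝔅 (λ B → 𝟙 (S ⊆? B)) * (k ∸ r)                       ≡⟨ ∑-*ʳ 𝔅 (k ∸ r) _ ⟨
    ∑ 𝔅 (λ B → 𝟙 (S ⊆? B) * (k ∸ r))                       ≡⟨ ∑-cong {xs = 𝔅} at-block ⟩
    ∑ 𝔅 (λ B → ∑ (allFin n) (λ x → 𝟙 (Y∖S x) * 𝟙 (S ∪ ⁅ x ⁆ ⊆? B)))
                                                           ≡⟨ ∑-swap 𝔅 (allFin n) _ ⟩
    ∑ (allFin n) (λ x → ∑ 𝔅 (λ B → 𝟙 (Y∖S x) * 𝟙 (S ∪ ⁅ x ⁆ ⊆? B)))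
                                                           ≡⟨ ∑-cong {xs = allFin n} (λ {x} _ → at-point x) ⟩
    ∑ (allFin n) (λ x → μ * 𝟙 (Y∖S x))                     ≡⟨ ∑-*ˡ (allFin n) μ _ ⟩
    μ * ∑ (allFin n) (λ x → 𝟙 (Y∖S x))                     ≡⟨ cong (μ *_) (∑-∖ S⊆Y) ⟩
    μ * (∣ Y ∣ ∸ ∣ S ∣)                                    ≡⟨ cong₂ (λ a b → μ * (a ∸ b)) order ∣S∣≡r ⟩
    μ * (v ∸ r)                                            ∎
    where
    open IsDesign D
    Y∖S : ∀ x → Dec (x ∈ Y × x ∉ S)
    Y∖S x = (x ∈? Y) ×-dec ¬? (x ∈? S)

    at-block : ∀ {B} → B List.∈ 𝔅 →
               𝟙 (S ⊆? B) * (k ∸ r) ≡ ∑ (allFin n) (λ x → 𝟙 (Y∖S x) * 𝟙 (S ∪ ⁅ x ⁆ ⊆? B))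
    at-block {B} B∈𝔅 with S ⊆? B
    ... | yes S⊆B = begin
      1 * (k ∸ r)                                                     ≡⟨ *-identityˡ (k ∸ r) ⟩
      k ∸ r                                                           ≡⟨ cong₂ _∸_ (blockSize B∈𝔅) ∣S∣≡r ⟨
      ∣ B ∣ ∸ ∣ S ∣                                                   ≡⟨ ∑-∖ S⊆B ⟨
      ∑ (allFin n) (λ x → 𝟙 ((x ∈? B) ×-dec ¬? (x ∈? S)))             ≡⟨ ∑-cong {xs = allFin n} (λ {x} _ → at x) ⟩
      ∑ (allFin n) (λ x → 𝟙 (Y∖S x) * 𝟙 (S ∪ ⁅ x ⁆ ⊆? B))             ∎
      where
      at : ∀ x → 𝟙 ((x ∈? B) ×-dec ¬? (x ∈? S)) ≡ 𝟙 (Y∖S x) * 𝟙 (S ∪ ⁅ x ⁆ ⊆? B)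
      at x = trans
        (𝟙-cong ((x ∈? B) ×-dec ¬? (x ∈? S)) (Y∖S x ×-dec (S ∪ ⁅ x ⁆ ⊆? B))
          (λ (x∈B , x∉S) → (onPoints B∈𝔅 x∈B , x∉S)
            , ∪-least S⊆B (λ y∈⁅x⁆ → subst (_∈ B) (sym (x∈⁅y⁆⇒x≡y x y∈⁅x⁆)) x∈B))
          (λ ((_ , x∉S) , S∪x⊆B) → S∪x⊆B (q⊆p∪q S ⁅ x ⁆ (x∈⁅x⁆ x)) , x∉S))
        (𝟙-× (Y∖S x) (S ∪ ⁅ x ⁆ ⊆? B))
    ... | no  S⊈B = begin
      0                                                    ≡⟨ *-zeroʳ (length (allFin n)) ⟨
      length (allFin n) * 0                                ≡⟨ ∑-const (allFin n) 0 ⟨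
      ∑ (allFin n) (λ _ → 0)                               ≡⟨ ∑-cong {xs = allFin n} (λ {x} _ → at x) ⟩
      ∑ (allFin n) (λ x → 𝟙 (Y∖S x) * 𝟙 (S ∪ ⁅ x ⁆ ⊆? B))  ∎
      where
      at : ∀ x → 0 ≡ 𝟙 (Y∖S x) * 𝟙 (S ∪ ⁅ x ⁆ ⊆? B)
      at x rewrite 𝟙-no (S ∪ ⁅ x ⁆ ⊆? B) (λ S∪x⊆B → S⊈B (⊆-trans (p⊆p∪q ⁅ x ⁆) S∪x⊆B)) = sym (*-zeroʳ (𝟙 (Y∖S x)))

    at-point : ∀ x → ∑ 𝔅 (λ B → 𝟙 (Y∖S x) * 𝟙 (S ∪ ⁅ x ⁆ ⊆? B)) ≡ μ * 𝟙 (Y∖S x)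
    at-point x = trans (∑-*ˡ 𝔅 (𝟙 (Y∖S x)) _) (trans extended (*-comm (𝟙 (Y∖S x)) μ))
      where
      extended : 𝟙 (Y∖S x) * ∑ 𝔅 (λ B → 𝟙 (S ∪ ⁅ x ⁆ ⊆? B)) ≡ 𝟙 (Y∖S x) * μ
      extended = 𝟙-*-cong (Y∖S x) λ (x∈Y , x∉S) → trans (sym (degree≡∑ (S ∪ ⁅ x ⁆) 𝔅))
        (balanced (S ∪ ⁅ x ⁆)
          (∪-least S⊆Y (λ y∈⁅x⁆ → subst (_∈ Y) (sym (x∈⁅y⁆⇒x≡y x y∈⁅x⁆)) x∈Y))
          (begin
            ∣ S ∪ ⁅ x ⁆ ∣      ≡⟨ ∣p∪q∣≡∣p∣+∣q∣ (λ y∈S y∈⁅x⁆ → x∉S (subst (_∈ S) (x∈⁅y⁆⇒x≡y x y∈⁅x⁆) y∈S)) ⟩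
            ∣ S ∣ + ∣ ⁅ x ⁆ ∣  ≡⟨ cong₂ _+_ ∣S∣≡r (∣⁅x⁆∣≡1 x) ⟩
            r + 1              ≡⟨ +-comm r 1 ⟩
            suc r              ∎))

-- This solves `degree-step` for the degree. The divisor is written `suc (k ∸ suc r)` to be visibly
-- nonzero; it equals k - r because r + 1 ≤ k. Divisibility need not be assumed: any r-subset of Y
-- exhibits the numerator as a multiple, and if there is none, `balanced` is vacuous.
reduce-strength : ∀ {Y : Subset n} {𝔅 r v k μ} →
  IsDesign Y 𝔅 (suc r) v k μ → IsDesign Y 𝔅 r v k (μ * (v ∸ r) / suc (k ∸ suc r))
reduce-strength {𝔅 = 𝔅} {r} {v} {k} {μ} D = record
  { order     = order
  ; strength  = <⇒≤ strength
  ; onPoints  = onPoints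
  ; blockSize = blockSize
  ; balanced  = λ S S⊆Y ∣S∣≡r → begin
      degree S 𝔅                                                ≡⟨ m*n/n≡m (degree S 𝔅) (suc (k ∸ suc r)) ⟨
      degree S 𝔅 * suc (k ∸ suc r) / suc (k ∸ suc r)            ≡⟨ cong (λ m → degree S 𝔅 * m / suc (k ∸ suc r)) (+-∸-assoc 1 strength) ⟨
      degree S 𝔅 * (k ∸ r) / suc (k ∸ suc r)                    ≡⟨ cong (_/ suc (k ∸ suc r)) (degree-step D S⊆Y ∣S∣≡r) ⟩
      μ * (v ∸ r) / suc (k ∸ suc r)                             ∎
  }
  where
  open IsDesign D
  open ≡-Reasoning

-- The reduced index depends on the parameters only: this makes λ*_r the same for all classes.
lower-strength : ∀ {r t} v k μ → r ≤ t →
  ∃ λ μ′ → ∀ {n} {Y : Subset n} {𝔅} → IsDesign Y 𝔅 t v k μ → IsDesign Y 𝔅 r v k μ′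
lower-strength v k μ r≤t = go μ (≤⇒≤′ r≤t)
  where
  go : ∀ {r t} μ → r ≤′ t → ∃ λ μ′ → ∀ {n} {Y : Subset n} {𝔅} → IsDesign Y 𝔅 t v k μ → IsDesign Y 𝔅 r v k μ′
  go μ ≤′-refl                 = μ , id
  go {t = suc t} μ (≤′-step p) =
    let μ′ , lower = go (μ * (v ∸ t) / suc (k ∸ suc t)) p in μ′ , λ D → lower (reduce-strength D)

firstPoints-⊆ : ∀ r (Y : Subset n) → firstPoints r Y ⊆ Y
firstPoints-⊆ r       []            = ⊆-refl
firstPoints-⊆ zero    (_ ∷ Y)       = out⊆ (firstPoints-⊆ zero Y)
firstPoints-⊆ (suc r) (inside ∷ Y)  = in⊆in (firstPoints-⊆ r Y)
firstPoints-⊆ (suc r) (outside ∷ Y) = out⊆ (firstPoints-⊆ (suc r) Y)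

∣firstPoints∣ : ∀ {r} {Y : Subset n} → r ≤ ∣ Y ∣ → ∣ firstPoints r Y ∣ ≡ r
∣firstPoints∣ {r = zero}  {[]}          _         = refl
∣firstPoints∣ {r = zero}  {_ ∷ Y}       _         = ∣firstPoints∣ {Y = Y} z≤n
∣firstPoints∣ {r = suc r} {inside ∷ Y}  (s≤s r≤Y) = cong suc (∣firstPoints∣ {Y = Y} r≤Y)
∣firstPoints∣ {r = suc r} {outside ∷ Y} r≤Y       = ∣firstPoints∣ {Y = Y} r≤Y

degree≡0 : ∀ {S : Subset n} {𝔅 i r} → (∀ {B} → B List.∈ 𝔅 → ∣ B ∣ ≡ i) → i < r → ∣ S ∣ ≡ r → degree S 𝔅 ≡ 0
degree≡0 {S = S} {𝔅} size i<r ∣S∣≡r = trans (degree≡∑ S 𝔅)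
    (trans (∑-cong {xs = 𝔅} (λ {B} B∈𝔅 → 𝟙-no (S ⊆? B) (λ S⊆B →
              <⇒≱ i<r (subst (_≤ _) ∣S∣≡r (subst (_ ≤_) (size B∈𝔅) (p⊆q⇒∣p∣≤∣q∣ S⊆B))))))
           (trans (∑-const 𝔅 0) (*-zeroʳ (length 𝔅))))

if-T : ∀ {b} {x y : A} → T b → (if b then x else y) ≡ x
if-T {b = true} _ = refl

if-F : ∀ {b} {x y : A} → ¬ T b → (if b then x else y) ≡ y
if-F {b = true}  ¬t = contradiction _ ¬t
if-F {b = false} _  = refl

module _ {Y : Subset n} {r : ℕ} where
  -- The guard r ≤ |Y| in `lam` is met because S is itself an r-subset of Y, so constancy lets S be
  -- exchanged for `firstPoints r Y`.
  lam-≡ : ∀ 𝔅 {S} → S ⊆ Y → ∣ S ∣ ≡ r → (∀ {S′} → S′ ⊆ Y → ∣ S′ ∣ ≡ r → degree S 𝔅 ≡ degree S′ 𝔅) →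
          degree S 𝔅 ≡ lam Y 𝔅 r
  lam-≡ 𝔅 {S} S⊆Y ∣S∣≡r constant =
    trans (constant (firstPoints-⊆ r Y) (∣firstPoints∣ {Y = Y} r≤∣Y∣)) (sym (if-T (≤⇒≤ᵇ r≤∣Y∣)))
    where
    r≤∣Y∣ : r ≤ ∣ Y ∣
    r≤∣Y∣ = subst (_≤ ∣ Y ∣) ∣S∣≡r (p⊆q⇒∣p∣≤∣q∣ S⊆Y)

  -- Two designs with the same parameters share the lowered index, so a degree in one may be read
  -- off in the other. With 𝔅′ the first class this compares classes; with 𝔅′ = 𝔅 it gives the
  -- ordinary λ_r.
  degree≡lam : ∀ {𝔅 𝔅′ S t v k μ} → IsDesign Y 𝔅 t v k μ → IsDesign Y 𝔅′ t v k μ →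
               r ≤ t → S ⊆ Y → ∣ S ∣ ≡ r → degree S 𝔅 ≡ lam Y 𝔅′ r
  degree≡lam {𝔅} {𝔅′} {S} {v = v} {k} {μ} D D′ r≤t S⊆Y ∣S∣≡r =
    trans (trans (IsDesign.balanced (lower D) S S⊆Y ∣S∣≡r)
                 (sym (IsDesign.balanced (lower D′) S S⊆Y ∣S∣≡r)))
          (lam-≡ 𝔅′ S⊆Y ∣S∣≡r (λ {S′} S′⊆Y ∣S′∣≡r →
            trans (IsDesign.balanced (lower D′) S S⊆Y ∣S∣≡r)
                  (sym (IsDesign.balanced (lower D′) S′ S′⊆Y ∣S′∣≡r))))
    where
    lower : ∀ {𝔅} → IsDesign Y 𝔅 _ v k μ → IsDesign Y 𝔅 r v k _
    lower = proj₂ (lower-strength v k μ r≤t)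

⊆∧∣∣≡⇒≡ : {p q : Subset n} → p ⊆ q → ∣ p ∣ ≡ ∣ q ∣ → p ≡ q
⊆∧∣∣≡⇒≡ {p = p} {q} p⊆q ∣p∣≡∣q∣ = ⊆-antisym p⊆q q⊆p
  where
  q⊆p : q ⊆ p
  q⊆p {x} x∈q with x ∈? p
  ... | yes x∈p = x∈p
  ... | no  x∉p = contradiction ∣p∣≡∣q∣ (<⇒≢ (p⊂q⇒∣p∣<∣q∣ (p⊆q , x , x∈q , x∉p)))

-- An i-set lies in another i-set only if they are equal, and it is listed exactly once, so the
-- index is 1. The strength is i even when t is larger, since `IsDesign` bounds it by the block
-- size.
complete-isDesign : ∀ {Y : Subset n} {𝔅 i} → IsComplete Y 𝔅 i → IsDesign Y 𝔅 i ∣ Y ∣ i 1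
complete-isDesign {Y = Y} {𝔅} {i} (𝔅! , char) = record
  { order     = refl
  ; strength  = ≤-refl
  ; onPoints  = λ B∈𝔅 → proj₁ (Equivalence.to (char _) B∈𝔅)
  ; blockSize = size
  ; balanced  = λ S S⊆Y ∣S∣≡i →
      trans (degree≡∑ S 𝔅) (occurs-once 𝔅! size ∣S∣≡i (Equivalence.from (char S) (S⊆Y , ∣S∣≡i)))
  }
  where
  size : ∀ {B} → B List.∈ 𝔅 → ∣ B ∣ ≡ i
  size B∈𝔅 = proj₂ (Equivalence.to (char _) B∈𝔅)

  occurs-once : ∀ {S 𝔅} → Unique 𝔅 → (∀ {B} → B List.∈ 𝔅 → ∣ B ∣ ≡ i) → ∣ S ∣ ≡ i → S List.∈ 𝔅 →
                ∑ 𝔅 (λ B → 𝟙 (S ⊆? B)) ≡ 1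
  occurs-once {S} {B ∷ 𝔅} (B∉𝔅 ∷ 𝔅!) size ∣S∣≡i (here refl) =
    cong₂ _+_ (𝟙-yes (S ⊆? S) ⊆-refl)
      (trans (∑-cong {xs = 𝔅} (λ {B′} B′∈𝔅 → 𝟙-no (S ⊆? B′) (λ S⊆B′ →
                All.lookup B∉𝔅 B′∈𝔅 (⊆∧∣∣≡⇒≡ S⊆B′ (trans ∣S∣≡i (sym (size (there B′∈𝔅))))))))
             (trans (∑-const 𝔅 0) (*-zeroʳ (length 𝔅))))
  occurs-once {S} {B ∷ 𝔅} (B∉𝔅 ∷ 𝔅!) size ∣S∣≡i (there S∈𝔅) =
    cong₂ _+_ (𝟙-no (S ⊆? B) (λ S⊆B →
                 All.lookup B∉𝔅 S∈𝔅 (sym (⊆∧∣∣≡⇒≡ S⊆B (trans ∣S∣≡i (sym (size (here refl))))))))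
              (occurs-once 𝔅! (size ∘ there) ∣S∣≡i S∈𝔅)

-- There is no bound on r: above i no block is large enough, so the degree is constantly 0. This
-- yields λ_r for all r ≤ t when D_i is complete with i < t.
complete-degree≡lam : ∀ {Y S : Subset n} {𝔅 i r} → IsComplete Y 𝔅 i → S ⊆ Y → ∣ S ∣ ≡ r →
                      degree S 𝔅 ≡ lam Y 𝔅 r
complete-degree≡lam {𝔅 = 𝔅} {i} {r} complete S⊆Y ∣S∣≡r with r ≤? i
... | yes r≤i = degree≡lam D D r≤i S⊆Y ∣S∣≡r
  where D = complete-isDesign complete
... | no  r≰i = lam-≡ 𝔅 S⊆Y ∣S∣≡r (λ _ ∣S′∣≡r → trans (vanish ∣S∣≡r) (sym (vanish ∣S′∣≡r)))
  where
  vanish : ∀ {S} → ∣ S ∣ ≡ r → degree S 𝔅 ≡ 0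
  vanish = degree≡0 (IsDesign.blockSize (complete-isDesign complete)) (≰⇒> r≰i)

-- Circulant sums

-- The summand lives on ℕ rather than `Fin n`, so that ranges can be split and indices shifted
-- freely.
∑< : ℕ → (ℕ → ℕ) → ℕ
∑< n f = sum (applyUpTo f n)

∑-allFin : ∀ n (f : ℕ → ℕ) → ∑ (allFin n) (f ∘ toℕ) ≡ ∑< n f
∑-allFin n f = trans (cong sum (map-tabulate {n = n} id (f ∘ toℕ))) (go n f)
  where
  go : ∀ n f → sum (tabulate {n = n} (f ∘ toℕ)) ≡ ∑< n f
  go zero    f = refl
  go (suc n) f = cong (f 0 +_) (go n (f ∘ suc))

∑<-cong : ∀ n {f g} → (∀ i → i < n → f i ≡ g i) → ∑< n f ≡ ∑< n g
∑<-cong zero    f≡g = refl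
∑<-cong (suc n) f≡g = cong₂ _+_ (f≡g 0 z<s) (∑<-cong n (λ i i<n → f≡g (suc i) (s<s i<n)))

∑<-const : ∀ n c → ∑< n (λ _ → c) ≡ n * c
∑<-const zero    c = refl
∑<-const (suc n) c = cong (c +_) (∑<-const n c)

∑<-last : ∀ n f → ∑< (suc n) f ≡ ∑< n f + f n
∑<-last n f = begin
  sum (applyUpTo f (suc n))            ≡⟨ cong sum (applyUpTo-∷ʳ f n) ⟨
  sum (applyUpTo f n ++ f n ∷ [])      ≡⟨ sum-++ (applyUpTo f n) (f n ∷ []) ⟩
  ∑< n f + (f n + 0)                   ≡⟨ cong (∑< n f +_) (+-identityʳ (f n)) ⟩
  ∑< n f + f n                         ∎
  where open ≡-Reasoning

∑<-+ : ∀ m n f → ∑< (m + n) f ≡ ∑< m f + ∑< n (λ i → f (m + i))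
∑<-+ zero    n f = refl
∑<-+ (suc m) n f = trans (cong (f 0 +_) (∑<-+ m n (f ∘ suc))) (sym (+-assoc (f 0) _ _))

-- Moving the base point h to h + 1 replaces the term at distance N - 1 - h by
-- the one at distance h + 1.
∑<-cyclic : ∀ N g → (∀ d → d ≤ N → g d ≡ g (N ∸ d)) → ∀ h → h < N → ∑< N (λ j → g ∣ h - j ∣) ≡ ∑< N g
∑<-cyclic N       g symm zero    _     = refl
∑<-cyclic (suc N) g symm (suc h) 1+h<N = begin
  g (suc h) + ∑< N (λ j → g ∣ h - j ∣)    ≡⟨ +-comm (g (suc h)) _ ⟩
  ∑< N (λ j → g ∣ h - j ∣) + g (suc h)    ≡⟨ cong (∑< N (λ j → g ∣ h - j ∣) +_) (symm (suc h) (<⇒≤ 1+h<N)) ⟩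
  ∑< N (λ j → g ∣ h - j ∣) + g (N ∸ h)    ≡⟨ cong (λ d → ∑< N (λ j → g ∣ h - j ∣) + g d) (m≤n⇒∣m-n∣≡n∸m (<⇒≤ (≤-pred 1+h<N))) ⟨
  ∑< N (λ j → g ∣ h - j ∣) + g ∣ h - N ∣  ≡⟨ ∑<-last N (λ j → g ∣ h - j ∣) ⟨
  ∑< (suc N) (λ j → g ∣ h - j ∣)          ≡⟨ ∑<-cyclic (suc N) g symm h (<⇒≤ 1+h<N) ⟩
  ∑< (suc N) g                            ∎
  where open ≡-Reasoning

within? : ∀ ε w d → Dec (ε ≤ d × d ≤ w)
within? ε w d = (ε ≤? d) ×-dec (d ≤? w)

-- `z i` unfolds to this. For w ≤ N/2 there are two residues at each distance 1,...,w from a given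
-- one, and one at distance 0, which ε = 1 removes; when 2w = N the two residues at distance w
-- coincide, which costs one.
circulantDegree : (N ε w : ℕ) → ℕ
circulantDegree N ε w = if 2 * w <ᵇ N then 2 * w + 1 ∸ ε else 2 * w ∸ ε

∑<-≥ : ∀ n e → ∑< n (λ d → 𝟙 (e ≤? d)) ≡ n ∸ e
∑<-≥ zero    e       = sym (0∸n≡0 e)
∑<-≥ (suc n) zero    = cong suc (trans (∑<-cong n (λ _ _ → refl)) (trans (∑<-const n 1) (*-identityʳ n)))
∑<-≥ (suc n) (suc e) = trans (∑<-cong n (λ d _ → 𝟙-cong (suc e ≤? suc d) (e ≤? d) ≤-pred s≤s)) (∑<-≥ n e)

module _ {N e w : ℕ} (e≤1 : e ≤ 1) (w≤N/2 : w ≤ ⌊ N /2⌋) where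
  open ≡-Reasoning

  private
    g : ℕ → ℕ
    g d = 𝟙 (within? e w (d ⊓ (N ∸ d)))

    w+w≤N : w + w ≤ N
    w+w≤N = ≤-trans (+-mono-≤ w≤N/2 (≤-trans w≤N/2 (⌊n/2⌋≤⌈n/2⌉ N))) (≤-reflexive (⌊n/2⌋+⌈n/2⌉≡n N))

    2w≡w+w : 2 * w ≡ w + w
    2w≡w+w = cong (w +_) (+-identityʳ w)

    -- At positive distance from 0 in ℤ/N the lower bound is automatic.
    g≡𝟙≥ : ∀ d → d < N → d ⊓ (N ∸ d) ≤ w → g d ≡ 𝟙 (e ≤? d)
    g≡𝟙≥ d d<N d≤w = 𝟙-cong (within? e w (d ⊓ (N ∸ d))) (e ≤? d)
      (λ (e≤ , _) → ≤-trans e≤ (m⊓n≤m d (N ∸ d)))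
      (λ e≤d → ⊓-glb e≤d (≤-trans e≤1 (m<n⇒0<n∸m d<N)) , d≤w)

    -- The residues split into 0,...,w, then c = N - 2w - 1 residues farther than w from 0 both ways
    -- round, then the last w, whose distances wrap around to w,...,1. They contribute w + 1 - e, 0
    -- and w.
    count-< : w + w < N → ∑< N g ≡ w + w + 1 ∸ e
    count-< 2w<N = begin
      ∑< N g                                                   ≡⟨ cong (λ m → ∑< m g) N≡ ⟩
      ∑< (suc w + (c + w)) g                                   ≡⟨ ∑<-+ (suc w) (c + w) g ⟩
      ∑< (suc w) g + ∑< (c + w) (λ i → g (suc w + i))          ≡⟨ cong₂ _+_ near (trans (∑<-+ c w _) (cong₂ _+_ middle far)) ⟩
      (suc w ∸ e) + w                                          ≡⟨ +-∸-comm w (≤-trans e≤1 (s≤s z≤n)) ⟨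
      suc w + w ∸ e                                            ≡⟨ cong (_∸ e) (+-comm 1 (w + w)) ⟩
      w + w + 1 ∸ e                                            ∎
      where
      c : ℕ
      c = N ∸ suc (w + w)

      N≡ : N ≡ suc w + (c + w)
      N≡ = begin
        N                  ≡⟨ m+[n∸m]≡n 2w<N ⟨
        suc (w + w) + c    ≡⟨ +-assoc (suc w) w c ⟩
        suc w + (w + c)    ≡⟨ cong (suc w +_) (+-comm w c) ⟩
        suc w + (c + w)    ∎

      near : ∑< (suc w) g ≡ suc w ∸ e
      near = trans (∑<-cong (suc w) (λ d d<1+w → g≡𝟙≥ d
               (≤-trans d<1+w (≤-trans (s≤s (m≤m+n w w)) 2w<N))
               (≤-trans (m⊓n≤m d _) (≤-pred d<1+w)))) (∑<-≥ (suc w) e)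

      middle : ∑< c (λ i → g (suc w + i)) ≡ 0
      middle = trans (∑<-cong c (λ i i<c → 𝟙-no (within? e w _) (λ (_ , d≤w) →
                 <⇒≱ (⊓-glb (s≤s (m≤m+n w i)) (rest i i<c)) d≤w))) (trans (∑<-const c 0) (*-zeroʳ c))
        where
        rest : ∀ i → i < c → w < N ∸ (suc w + i)
        -- The subtraction is moved across: (w + 1) + (w + 1 + i) regroups as (w + 1) + ((i + 1) +
        -- w), which is at most N = (w + 1) + (c + w) because i < c.
        rest i i<c = m+n≤o⇒m≤o∸n (suc w) (≤-trans (≤-reflexive (+-comm (suc w) (suc w + i)))
          (≤-trans (≤-reflexive (trans (+-assoc (suc w) i (suc w)) (cong (suc w +_) (+-suc i w))))
          (≤-trans (+-monoʳ-≤ (suc w) (+-monoˡ-≤ w i<c)) (≤-reflexive (sym N≡)))))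

      far : ∑< w (λ i → g (suc w + (c + i))) ≡ w
      far = trans (∑<-cong w (λ i i<w → trans
              (g≡𝟙≥ _ (subst (suc w + (c + i) <_) (sym N≡) (+-monoʳ-< (suc w) (+-monoʳ-< c i<w)))
                 (≤-trans (m⊓n≤n (suc w + (c + i)) _) (≤-trans (≤-reflexive (remaining i)) (m∸n≤m w i))))
              (𝟙-yes (e ≤? _) (≤-trans e≤1 (s≤s z≤n)))))
            (trans (∑<-const w 1) (*-identityʳ w))
        where
        remaining : ∀ i → N ∸ (suc w + (c + i)) ≡ w ∸ i
        remaining i = begin
          N ∸ (suc w + (c + i))                ≡⟨ cong (_∸ (suc w + (c + i))) N≡ ⟩
          suc w + (c + w) ∸ (suc w + (c + i))  ≡⟨ [m+n]∸[m+o]≡n∸o (suc w) _ _ ⟩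
          c + w ∸ (c + i)                      ≡⟨ [m+n]∸[m+o]≡n∸o c w i ⟩
          w ∸ i                                ∎

    -- One of the two arcs from 0 to d has length at most N/2 = w, so the upper bound always holds
    -- and only the lower bound can exclude a residue.
    count-≡ : w + w ≡ N → ∑< N g ≡ w + w ∸ e
    count-≡ 2w≡N = trans (∑<-cong N (λ d d<N → g≡𝟙≥ d d<N (closer d)))
                         (trans (∑<-≥ N e) (cong (_∸ e) (sym 2w≡N)))
      where
      closer : ∀ d → d ⊓ (N ∸ d) ≤ w
      closer d with d ≤? w
      ... | yes d≤w = ≤-trans (m⊓n≤m d _) d≤w
      ... | no  d≰w = ≤-trans (m⊓n≤n d _) (≤-trans (∸-monoʳ-≤ N (<⇒≤ (≰⇒> d≰w)))
                        (≤-reflexive (trans (cong (_∸ w) (sym 2w≡N)) (m+n∸n≡m w w))))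

    count : ∑< N g ≡ circulantDegree N e w
    count with 2 * w <? N
    ... | yes 2w<N = trans (count-< (subst (_< N) 2w≡w+w 2w<N))
                       (trans (cong (λ m → m + 1 ∸ e) (sym 2w≡w+w)) (sym (if-T (<⇒<ᵇ 2w<N))))
    ... | no  2w≮N = trans (count-≡ (≤-antisym w+w≤N (subst (N ≤_) 2w≡w+w (≮⇒≥ 2w≮N))))
                       (trans (cong (_∸ e) (sym 2w≡w+w)) (sym (if-F (2w≮N ∘ <ᵇ⇒< (2 * w) N))))

  -- The circular distance depends on |h - j| through a function symmetric under d ↦ N - d, so the
  -- row of h can be rotated to the row of 0, where the count is explicit.
  count-within : ∀ (h : Fin N) → ∑ (allFin N) (λ j → 𝟙 (within? e w (dist N (toℕ h) (toℕ j)))) ≡ circulantDegree N e w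
  count-within h = begin
    ∑ (allFin N) (λ j → g ∣ toℕ h - toℕ j ∣)  ≡⟨ ∑-allFin N (λ j → g ∣ toℕ h - j ∣) ⟩
    ∑< N (λ j → g ∣ toℕ h - j ∣)              ≡⟨ ∑<-cyclic N g symm (toℕ h) (toℕ<n h) ⟩
    ∑< N g                                    ≡⟨ count ⟩
    circulantDegree N e w                              ∎
    where
    symm : ∀ d → d ≤ N → g d ≡ g (N ∸ d)
    symm d d≤N = cong (𝟙 ∘ within? e w)
      (trans (⊓-comm d (N ∸ d)) (cong ((N ∸ d) ⊓_) (sym (m∸[m∸n]≡n d≤N))))

  count-withinˡ : ∀ (j : Fin N) → ∑ (allFin N) (λ h → 𝟙 (within? e w (dist N (toℕ h) (toℕ j)))) ≡ circulantDegree N e w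
  count-withinˡ j = trans
    (∑-cong {xs = allFin N} (λ {h} _ → cong (λ m → 𝟙 (within? e w (m ⊓ (N ∸ m)))) (∣-∣-comm (toℕ h) (toℕ j))))
    (count-within j)

-- Joins of classes

Unique-++⁻ : ∀ (xs : List A) {ys} → Unique (xs ++ ys) →
             Unique xs × Unique ys × (∀ {x} → x List.∈ xs → ¬ x List.∈ ys)
Unique-++⁻ []       ys!              = [] , ys! , λ ()
Unique-++⁻ (x ∷ xs) (x∉xs++ys ∷ !) =
  let xs! , ys! , xs#ys = Unique-++⁻ xs ! in
    (All.tabulate (λ y∈xs → All.lookup x∉xs++ys (∈-++⁺ˡ y∈xs)) ∷ xs!)
  , ys!
  , λ { (here refl)  x∈ys → All.lookup x∉xs++ys (∈-++⁺ʳ xs x∈ys) refl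
      ; (there y∈xs) y∈ys → xs#ys y∈xs y∈ys }

-- Disjointness is phrased as agreement of indices on a common element, because here the index (the
-- pair of classes, or i) is always recovered from the block.
Unique-concatMap⁺ : ∀ {f : A → List B} {xs} → Unique xs →
                    (∀ {x} → x List.∈ xs → Unique (f x)) →
                    (∀ {x y b} → x List.∈ xs → y List.∈ xs → b List.∈ f x → b List.∈ f y → x ≡ y) →
                    Unique (concatMap f xs)
Unique-concatMap⁺ {xs = []}    _          _   _        = []
Unique-concatMap⁺ {xs = x ∷ xs} (x∉xs ∷ xs!) fx! disjoint =
  Unique.++⁺ (fx! (here refl))
    (Unique-concatMap⁺ xs! (fx! ∘ there) (λ y∈ z∈ → disjoint (there y∈) (there z∈)))
    (λ (b∈fx , b∈rest) → let y , y∈xs , b∈fy = List.find (∈-concatMap⁻ _ {xs = xs} b∈rest) in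
      All.lookup x∉xs y∈xs (disjoint (here refl) (there y∈xs) b∈fx b∈fy))

-- Mapping g over the combined list gives back the list of pairs, which has no repetitions. The
-- retraction is asked for on the listed elements only: a union of blocks decodes only when its
-- parts lie in X₁ and X₂.
Unique-cartesianProductWith⁺ : ∀ {f : A → B → C} {g : C → A × B} xs ys →
  (∀ {x y} → x List.∈ xs → y List.∈ ys → g (f x y) ≡ (x , y)) →
  Unique xs → Unique ys → Unique (cartesianProductWith f xs ys)
Unique-cartesianProductWith⁺ {f = f} {g} xs ys retraction xs! ys! =
  Unique.map⁻ {f = g} (subst Unique (sym (unmap xs retraction)) (Unique.cartesianProduct⁺ xs! ys!))
  where
  unmap : ∀ xs → (∀ {x y} → x List.∈ xs → y List.∈ ys → g (f x y) ≡ (x , y)) →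
          map g (cartesianProductWith f xs ys) ≡ cartesianProduct xs ys
  unmap []       _          = refl
  unmap (x ∷ xs) retraction = trans (map-++ g (map (f x) ys) _)
    (cong₂ _++_ (trans (sym (map-∘ ys)) (map-cong-local (All.tabulate (retraction (here refl)))))
                (unmap xs (retraction ∘ there)))

module _ {𝔄 : Fin N → List A} where
  classes-unique : Unique (concat (tabulate 𝔄)) → ∀ h → Unique (𝔄 h)
  classes-unique = go 𝔄
    where
    go : ∀ {N} (𝔄 : Fin N → List A) → Unique (concat (tabulate 𝔄)) → ∀ h → Unique (𝔄 h)
    go 𝔄 ! zero    = proj₁ (Unique-++⁻ (𝔄 zero) !)
    go 𝔄 ! (suc h) = go (𝔄 ∘ suc) (proj₁ (proj₂ (Unique-++⁻ (𝔄 zero) !))) h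

  ∈-classes : ∀ {B h} → B List.∈ 𝔄 h → B List.∈ concat (tabulate 𝔄)
  ∈-classes {h = h} B∈ = ∈-concat⁺′ B∈ (∈-tabulate⁺ h)

classes-disjoint : ∀ {𝔄 : Fin N → List A} → Unique (concat (tabulate 𝔄)) →
                   ∀ {B h j} → B List.∈ 𝔄 h → B List.∈ 𝔄 j → h ≡ j
classes-disjoint             ! {h = zero}  {zero}  _   _   = refl
classes-disjoint {𝔄 = 𝔄}     ! {h = zero}  {suc j} B∈h B∈j =
  contradiction (∈-classes {𝔄 = 𝔄 ∘ suc} B∈j) (proj₂ (proj₂ (Unique-++⁻ (𝔄 zero) !)) B∈h)
classes-disjoint {𝔄 = 𝔄}     ! {h = suc h} {zero}  B∈h B∈j =
  contradiction (∈-classes {𝔄 = 𝔄 ∘ suc} B∈h) (proj₂ (proj₂ (Unique-++⁻ (𝔄 zero) !)) B∈j)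
classes-disjoint {𝔄 = 𝔄}     ! {h = suc h} {suc j} B∈h B∈j =
  cong suc (classes-disjoint {𝔄 = 𝔄 ∘ suc} (proj₁ (proj₂ (Unique-++⁻ (𝔄 zero) !))) B∈h B∈j)

Unique-resp-↭ : ∀ {xs ys : List A} → xs ↭ ys → Unique xs → Unique ys
Unique-resp-↭ p = ↭ₛ.Unique-resp-↭ (setoid _) (↭⇒↭ₛ p)

classes-degree : ∀ {Y S : Subset n} {𝔄 : Fin N → Blocks n} {s v k μ r} →
  (∀ h → IsDesign Y (𝔄 h) s v k μ) → r ≤ s → S ⊆ Y → ∣ S ∣ ≡ r → ∀ h → degree S (𝔄 h) ≡ lam* Y 𝔄 r
classes-degree {N = suc _} D r≤s S⊆Y ∣S∣≡r h = degree≡lam (D h) (D zero) r≤s S⊆Y ∣S∣≡r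

-- For the factor in which |S| exceeds the strength of the classes: single degrees are then out of
-- control, but their total is not.
∑-degree-classes : ∀ {S : Subset n} {𝔄 : Fin N → Blocks n} {𝔅} → IsPartitionOf 𝔄 𝔅 →
                   ∑ (allFin N) (λ h → degree S (𝔄 h)) ≡ degree S 𝔅
∑-degree-classes {N = N} {S} {𝔄} {𝔅} part = begin
  ∑ (allFin N) (λ h → degree S (𝔄 h))           ≡⟨ ∑-cong {xs = allFin N} (λ {h} _ → degree≡∑ S (𝔄 h)) ⟩
  ∑ (allFin N) (λ h → ∑ (𝔄 h) χ)                ≡⟨ ∑-concatMap 𝔄 (allFin N) χ ⟨
  ∑ (concatMap 𝔄 (allFin N)) χ                  ≡⟨ cong (λ 𝔅s → ∑ (concat 𝔅s) χ) (map-tabulate {n = N} id 𝔄) ⟩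
  ∑ (concat (tabulate 𝔄)) χ                     ≡⟨ sum-↭ (map⁺ χ part) ⟩
  ∑ 𝔅 χ                                         ≡⟨ degree≡∑ S 𝔅 ⟨
  degree S 𝔅                                    ∎
  where
  open ≡-Reasoning
  χ : Subset _ → ℕ
  χ B = 𝟙 (S ⊆? B)

-- D_i is described by completeness for i ≤ t and as a simple t-design beyond; the consequences
-- drawn here hide that distinction, for X₁ and X₂ alike.
module Component {Y : Subset n} {𝔅 : Blocks n} {t v i : ℕ}
  (complete : i ≤ t → IsComplete Y 𝔅 i) (design : t < i → IsSimpleDesign Y 𝔅 t v i (lam Y 𝔅 t)) where

  lam-degree : ∀ {S r} → r ≤ t → S ⊆ Y → ∣ S ∣ ≡ r → degree S 𝔅 ≡ lam Y 𝔅 r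
  lam-degree r≤t with i ≤? t
  ... | yes i≤t = complete-degree≡lam (complete i≤t)
  ... | no  i≰t = degree≡lam D D r≤t
    where D = proj₁ (design (≰⇒> i≰t))

  on-points : ∀ {B} → B List.∈ 𝔅 → B ⊆ Y
  on-points with i ≤? t
  ... | yes i≤t = IsDesign.onPoints (complete-isDesign (complete i≤t))
  ... | no  i≰t = IsDesign.onPoints (proj₁ (design (≰⇒> i≰t)))

  block-size : ∀ {B} → B List.∈ 𝔅 → ∣ B ∣ ≡ i
  block-size with i ≤? t
  ... | yes i≤t = IsDesign.blockSize (complete-isDesign (complete i≤t))
  ... | no  i≰t = IsDesign.blockSize (proj₁ (design (≰⇒> i≰t)))

  unique : Unique 𝔅
  unique with i ≤? t
  ... | yes i≤t = proj₁ (complete i≤t)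
  ... | no  i≰t = proj₂ (design (≰⇒> i≰t))

-- `𝔅* i` unfolds to an instance of this. N and N′ are kept apart because for the given data they
-- are only propositionally equal.
circulant : (e w : ℕ) → (Fin N → Blocks n) → (Fin N′ → Blocks n) → Blocks n
circulant {N = N} {N′ = N′} e w 𝔄₁ 𝔄₂ = concatMap (λ (h , j) → join (𝔄₁ h) (𝔄₂ j))
  (filter (λ (h , j) → within? e w (dist N (toℕ h) (toℕ j))) (cartesianProduct (allFin N) (allFin N′)))

module _ {e w : ℕ} (e≤1 : e ≤ 1) (w≤N/2 : w ≤ ⌊ N /2⌋) (a b : Fin N → ℕ) where
  open ≡-Reasoning
  private
    W : Fin N → Fin N → ℕ
    W h j = 𝟙 (within? e w (dist N (toℕ h) (toℕ j)))

  ∑-circulant-constʳ : ∀ {β} → (∀ j → b j ≡ β) →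
    ∑ (allFin N) (λ h → ∑ (allFin N) (λ j → W h j * (a h * b j))) ≡ ∑ (allFin N) a * β * circulantDegree N e w
  ∑-circulant-constʳ {β} b≡β = begin
    ∑ (allFin N) (λ h → ∑ (allFin N) (λ j → W h j * (a h * b j)))
      ≡⟨ ∑-cong {xs = allFin N} (λ {h} _ → ∑-cong {xs = allFin N} (λ {j} _ → cong (λ m → W h j * (a h * m)) (b≡β j))) ⟩
    ∑ (allFin N) (λ h → ∑ (allFin N) (λ j → W h j * (a h * β)))
      ≡⟨ ∑-cong {xs = allFin N} (λ {h} _ → ∑-*ʳ (allFin N) (a h * β) (W h)) ⟩
    ∑ (allFin N) (λ h → ∑ (allFin N) (W h) * (a h * β))
      ≡⟨ ∑-cong {xs = allFin N} (λ {h} _ → trans (cong (_* (a h * β)) (count-within e≤1 w≤N/2 h)) (*-comm (circulantDegree N e w) _)) ⟩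
    ∑ (allFin N) (λ h → a h * β * circulantDegree N e w)
      ≡⟨ ∑-*ʳ (allFin N) (circulantDegree N e w) _ ⟩
    ∑ (allFin N) (λ h → a h * β) * circulantDegree N e w
      ≡⟨ cong (_* circulantDegree N e w) (∑-*ʳ (allFin N) β a) ⟩
    ∑ (allFin N) a * β * circulantDegree N e w
      ∎

  ∑-circulant-constˡ : ∀ {α} → (∀ h → a h ≡ α) →
    ∑ (allFin N) (λ h → ∑ (allFin N) (λ j → W h j * (a h * b j))) ≡ α * ∑ (allFin N) b * circulantDegree N e w
  ∑-circulant-constˡ {α} a≡α = begin
    ∑ (allFin N) (λ h → ∑ (allFin N) (λ j → W h j * (a h * b j)))
      -- With a constant, the sum over h must become the inner one, so that column sums of W appear.
      ≡⟨ ∑-swap (allFin N) (allFin N) _ ⟩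
    ∑ (allFin N) (λ j → ∑ (allFin N) (λ h → W h j * (a h * b j)))
      ≡⟨ ∑-cong {xs = allFin N} (λ {j} _ → ∑-cong {xs = allFin N} (λ {h} _ → cong (λ m → W h j * (m * b j)) (a≡α h))) ⟩
    ∑ (allFin N) (λ j → ∑ (allFin N) (λ h → W h j * (α * b j)))
      ≡⟨ ∑-cong {xs = allFin N} (λ {j} _ → ∑-*ʳ (allFin N) (α * b j) (λ h → W h j)) ⟩
    ∑ (allFin N) (λ j → ∑ (allFin N) (λ h → W h j) * (α * b j))
      ≡⟨ ∑-cong {xs = allFin N} (λ {j} _ → trans (cong (_* (α * b j)) (count-withinˡ e≤1 w≤N/2 j)) (*-comm (circulantDegree N e w) _)) ⟩
    ∑ (allFin N) (λ j → α * b j * circulantDegree N e w)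
      ≡⟨ ∑-*ʳ (allFin N) (circulantDegree N e w) _ ⟩
    ∑ (allFin N) (λ j → α * b j) * circulantDegree N e w
      ≡⟨ cong (_* circulantDegree N e w) (∑-*ˡ (allFin N) α b) ⟩
    α * ∑ (allFin N) b * circulantDegree N e w
      ∎

∩-absorbˡ : {X₁ X₂ B₁ B₂ : Subset n} → (∀ {x} → x ∈ X₁ → x ∉ X₂) → B₁ ⊆ X₁ → B₂ ⊆ X₂ → (B₁ ∪ B₂) ∩ X₁ ≡ B₁
∩-absorbˡ {X₁ = X₁} {B₁ = B₁} {B₂} X₁#X₂ B₁⊆X₁ B₂⊆X₂ = ⊆-antisym ⊆ˡ (λ x∈B₁ → x∈p∩q⁺ (p⊆p∪q B₂ x∈B₁ , B₁⊆X₁ x∈B₁))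
  where
  ⊆ˡ : (B₁ ∪ B₂) ∩ X₁ ⊆ B₁
  ⊆ˡ x∈ with x∈B , x∈X₁ ← x∈p∩q⁻ (B₁ ∪ B₂) X₁ x∈ =
    [ id , (λ x∈B₂ → contradiction (B₂⊆X₂ x∈B₂) (X₁#X₂ x∈X₁)) ]′ (x∈p∪q⁻ B₁ B₂ x∈B)

∩-absorbʳ : {X₁ X₂ B₁ B₂ : Subset n} → (∀ {x} → x ∈ X₁ → x ∉ X₂) → B₁ ⊆ X₁ → B₂ ⊆ X₂ → (B₁ ∪ B₂) ∩ X₂ ≡ B₂
∩-absorbʳ {X₂ = X₂} {B₁} {B₂} X₁#X₂ B₁⊆X₁ B₂⊆X₂ =
  trans (cong (_∩ X₂) (∪-comm B₁ B₂)) (∩-absorbˡ (λ x∈X₂ x∈X₁ → X₁#X₂ x∈X₁ x∈X₂) B₂⊆X₂ B₁⊆X₁)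

-- Blocks over the two halves of the point set

module Joins {X₁ X₂ : Subset n} (cover : X₁ ∪ X₂ ≡ ⊤) (X₁#X₂ : ∀ {x} → x ∈ X₁ → x ∉ X₂) where
  open ≡-Reasoning

  ∣∩∣+∣∩∣ : ∀ T → ∣ T ∩ X₁ ∣ + ∣ T ∩ X₂ ∣ ≡ ∣ T ∣
  ∣∩∣+∣∩∣ T = begin
    ∣ T ∩ X₁ ∣ + ∣ T ∩ X₂ ∣   ≡⟨ ∣p∪q∣≡∣p∣+∣q∣ (λ x∈₁ x∈₂ → X₁#X₂ (p∩q⊆q T X₁ x∈₁) (p∩q⊆q T X₂ x∈₂)) ⟨
    ∣ T ∩ X₁ ∪ T ∩ X₂ ∣       ≡⟨ cong ∣_∣ (∩-distribˡ-∪ T X₁ X₂) ⟨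
    ∣ T ∩ (X₁ ∪ X₂) ∣         ≡⟨ cong (λ X → ∣ T ∩ X ∣) cover ⟩
    ∣ T ∩ ⊤ ∣                 ≡⟨ cong ∣_∣ (∩-identityʳ T) ⟩
    ∣ T ∣                     ∎

  -- A conjunction of a test on B₁ and a test on B₂ has a product as indicator, which is why the
  -- double sum over a join factors.
  ⊆∪-split : ∀ {T B₁ B₂} → B₁ ⊆ X₁ → B₂ ⊆ X₂ →
             𝟙 (T ⊆? B₁ ∪ B₂) ≡ 𝟙 (T ∩ X₁ ⊆? B₁) * 𝟙 (T ∩ X₂ ⊆? B₂)
  ⊆∪-split {T} {B₁} {B₂} B₁⊆X₁ B₂⊆X₂ = trans
    (𝟙-cong (T ⊆? B₁ ∪ B₂) ((T ∩ X₁ ⊆? B₁) ×-dec (T ∩ X₂ ⊆? B₂))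
      (λ T⊆B → (λ {x} → restrictˡ T⊆B {x}) , (λ {x} → restrictʳ T⊆B {x}))
      (λ (T₁⊆B₁ , T₂⊆B₂) {x} x∈T →
        [ (λ x∈X₁ → p⊆p∪q B₂ (T₁⊆B₁ (x∈p∩q⁺ (x∈T , x∈X₁))))
        , (λ x∈X₂ → q⊆p∪q B₁ B₂ (T₂⊆B₂ (x∈p∩q⁺ (x∈T , x∈X₂)))) ]′
        (x∈p∪q⁻ X₁ X₂ (subst (x ∈_) (sym cover) ∈⊤))))
    (𝟙-× (T ∩ X₁ ⊆? B₁) (T ∩ X₂ ⊆? B₂))
    where
    restrictˡ : T ⊆ B₁ ∪ B₂ → T ∩ X₁ ⊆ B₁
    restrictˡ T⊆B {x} x∈ with x∈T , x∈X₁ ← x∈p∩q⁻ T X₁ x∈ =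
      subst (x ∈_) (∩-absorbˡ X₁#X₂ B₁⊆X₁ B₂⊆X₂) (x∈p∩q⁺ (T⊆B x∈T , x∈X₁))
    restrictʳ : T ⊆ B₁ ∪ B₂ → T ∩ X₂ ⊆ B₂
    restrictʳ T⊆B {x} x∈ with x∈T , x∈X₂ ← x∈p∩q⁻ T X₂ x∈ =
      subst (x ∈_) (∩-absorbʳ X₁#X₂ B₁⊆X₁ B₂⊆X₂) (x∈p∩q⁺ (T⊆B x∈T , x∈X₂))

  module _ {𝔅₁ 𝔅₂ : Blocks n} (𝔅₁⊆X₁ : ∀ {B} → B List.∈ 𝔅₁ → B ⊆ X₁) (𝔅₂⊆X₂ : ∀ {B} → B List.∈ 𝔅₂ → B ⊆ X₂) where

    degree-join : ∀ T → degree T (join 𝔅₁ 𝔅₂) ≡ degree (T ∩ X₁) 𝔅₁ * degree (T ∩ X₂) 𝔅₂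
    degree-join T = begin
      degree T (join 𝔅₁ 𝔅₂)
        ≡⟨ degree≡∑ T (join 𝔅₁ 𝔅₂) ⟩
      ∑ (join 𝔅₁ 𝔅₂) (λ B → 𝟙 (T ⊆? B))
        ≡⟨ ∑-cartesianProductWith _∪_ 𝔅₁ 𝔅₂ _ ⟩
      ∑ 𝔅₁ (λ B₁ → ∑ 𝔅₂ (λ B₂ → 𝟙 (T ⊆? B₁ ∪ B₂)))
        ≡⟨ ∑-cong {xs = 𝔅₁} (λ B₁∈ → ∑-cong {xs = 𝔅₂} (λ B₂∈ → ⊆∪-split {T} (𝔅₁⊆X₁ B₁∈) (𝔅₂⊆X₂ B₂∈))) ⟩
      ∑ 𝔅₁ (λ B₁ → ∑ 𝔅₂ (λ B₂ → 𝟙 (T ∩ X₁ ⊆? B₁) * 𝟙 (T ∩ X₂ ⊆? B₂)))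
        ≡⟨ ∑-cong {xs = 𝔅₁} (λ {B₁} _ → ∑-*ˡ 𝔅₂ (𝟙 (T ∩ X₁ ⊆? B₁)) _) ⟩
      ∑ 𝔅₁ (λ B₁ → 𝟙 (T ∩ X₁ ⊆? B₁) * ∑ 𝔅₂ (λ B₂ → 𝟙 (T ∩ X₂ ⊆? B₂)))
        ≡⟨ ∑-*ʳ 𝔅₁ _ _ ⟩
      ∑ 𝔅₁ (λ B₁ → 𝟙 (T ∩ X₁ ⊆? B₁)) * ∑ 𝔅₂ (λ B₂ → 𝟙 (T ∩ X₂ ⊆? B₂))
        ≡⟨ cong₂ _*_ (degree≡∑ (T ∩ X₁) 𝔅₁) (degree≡∑ (T ∩ X₂) 𝔅₂) ⟨
      degree (T ∩ X₁) 𝔅₁ * degree (T ∩ X₂) 𝔅₂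
        ∎

    ∈-join⁻ : ∀ {B} → B List.∈ join 𝔅₁ 𝔅₂ → B ∩ X₁ List.∈ 𝔅₁ × B ∩ X₂ List.∈ 𝔅₂
    ∈-join⁻ B∈ with B₁ , B₂ , B₁∈ , B₂∈ , refl ← ∈-cartesianProductWith⁻ _∪_ 𝔅₁ 𝔅₂ B∈ =
      subst (List._∈ 𝔅₁) (sym (∩-absorbˡ X₁#X₂ (𝔅₁⊆X₁ B₁∈) (𝔅₂⊆X₂ B₂∈))) B₁∈ ,
      subst (List._∈ 𝔅₂) (sym (∩-absorbʳ X₁#X₂ (𝔅₁⊆X₁ B₁∈) (𝔅₂⊆X₂ B₂∈))) B₂∈

    join-unique : Unique 𝔅₁ → Unique 𝔅₂ → Unique (join 𝔅₁ 𝔅₂)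
    join-unique = Unique-cartesianProductWith⁺ {g = λ B → B ∩ X₁ , B ∩ X₂} 𝔅₁ 𝔅₂
      (λ B₁∈ B₂∈ → cong₂ _,_ (∩-absorbˡ X₁#X₂ (𝔅₁⊆X₁ B₁∈) (𝔅₂⊆X₂ B₂∈)) (∩-absorbʳ X₁#X₂ (𝔅₁⊆X₁ B₁∈) (𝔅₂⊆X₂ B₂∈)))

  module _ (e w : ℕ) (𝔄₁ : Fin N → Blocks n) (𝔄₂ : Fin N′ → Blocks n)
    (𝔄₁⊆X₁ : ∀ {h B} → B List.∈ 𝔄₁ h → B ⊆ X₁) (𝔄₂⊆X₂ : ∀ {j B} → B List.∈ 𝔄₂ j → B ⊆ X₂) where

    degree-circulant : ∀ T → degree T (circulant e w 𝔄₁ 𝔄₂) ≡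
      ∑ (allFin N) (λ h → ∑ (allFin N′) (λ j →
        𝟙 (within? e w (dist N (toℕ h) (toℕ j))) * (degree (T ∩ X₁) (𝔄₁ h) * degree (T ∩ X₂) (𝔄₂ j))))
    degree-circulant T = begin
      degree T (circulant e w 𝔄₁ 𝔄₂)
        ≡⟨ degree≡∑ T (circulant e w 𝔄₁ 𝔄₂) ⟩
      ∑ (circulant e w 𝔄₁ 𝔄₂) (λ B → 𝟙 (T ⊆? B))
        ≡⟨ ∑-concatMap _ (filter selected? pairs) _ ⟩
      ∑ (filter selected? pairs) (λ (h , j) → ∑ (join (𝔄₁ h) (𝔄₂ j)) (λ B → 𝟙 (T ⊆? B)))
        ≡⟨ ∑-filter selected? pairs _ ⟩
      ∑ pairs (λ (h , j) → 𝟙 (selected? (h , j)) * ∑ (join (𝔄₁ h) (𝔄₂ j)) (λ B → 𝟙 (T ⊆? B)))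
        ≡⟨ ∑-cong {xs = pairs} (λ {(h , j)} _ → cong (𝟙 (selected? (h , j)) *_)
             (trans (sym (degree≡∑ T (join (𝔄₁ h) (𝔄₂ j)))) (degree-join (𝔄₁⊆X₁ {h}) (𝔄₂⊆X₂ {j}) T))) ⟩
      ∑ pairs (λ (h , j) → 𝟙 (selected? (h , j)) * (degree (T ∩ X₁) (𝔄₁ h) * degree (T ∩ X₂) (𝔄₂ j)))
        ≡⟨ ∑-cartesianProductWith _,_ (allFin N) (allFin N′) _ ⟩
      _ ∎
      where
      pairs : List (Fin N × Fin N′)
      pairs = cartesianProduct (allFin N) (allFin N′)
      selected? : ((h , j) : Fin N × Fin N′) → Dec _
      selected? (h , j) = within? e w (dist N (toℕ h) (toℕ j))

    -- This transfers facts about blocks of a full join, namely their size and their intersection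
    -- with X₁, to starred blocks.
    circulant⊆join : ∀ {𝔅₁ 𝔅₂} → IsPartitionOf 𝔄₁ 𝔅₁ → IsPartitionOf 𝔄₂ 𝔅₂ →
                     ∀ {B} → B List.∈ circulant e w 𝔄₁ 𝔄₂ → B List.∈ join 𝔅₁ 𝔅₂
    circulant⊆join part₁ part₂ B∈ with (h , j) , B∈join ← satisfied (∈-concatMap⁻ _ {xs = filter _ (cartesianProduct (allFin N) (allFin N′))} B∈)
      with B₁ , B₂ , B₁∈ , B₂∈ , refl ← ∈-cartesianProductWith⁻ _∪_ (𝔄₁ h) (𝔄₂ j) B∈join =
      ∈-cartesianProductWith⁺ _∪_ (∈-resp-↭ part₁ (∈-classes {𝔄 = 𝔄₁} B₁∈)) (∈-resp-↭ part₂ (∈-classes {𝔄 = 𝔄₂} B₂∈))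

    circulant-unique : Unique (concat (tabulate 𝔄₁)) → Unique (concat (tabulate 𝔄₂)) →
                       Unique (circulant e w 𝔄₁ 𝔄₂)
    circulant-unique !₁ !₂ = Unique-concatMap⁺
      (Unique.filter⁺ _ (Unique.cartesianProduct⁺ (Unique.allFin⁺ N) (Unique.allFin⁺ N′)))
      (λ {(h , j)} _ → join-unique (𝔄₁⊆X₁ {h}) (𝔄₂⊆X₂ {j}) (classes-unique !₁ h) (classes-unique !₂ j))
      (λ {(h , j)} {(h′ , j′)} _ _ B∈ B∈′ →
        let B₁∈  , B₂∈  = ∈-join⁻ (𝔄₁⊆X₁ {h}) (𝔄₂⊆X₂ {j}) B∈
            B₁∈′ , B₂∈′ = ∈-join⁻ (𝔄₁⊆X₁ {h′}) (𝔄₂⊆X₂ {j′}) B∈′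
        in cong₂ _,_ (classes-disjoint !₁ B₁∈ B₁∈′) (classes-disjoint !₂ B₂∈ B₂∈′))

degree-×[] : ∀ (T : Subset n) 𝔅 u → degree T (𝔅 ×[ u ]) ≡ toℕ u * degree T 𝔅
degree-×[] T 𝔅 zero       = refl
degree-×[] T 𝔅 (suc zero) = sym (+-identityʳ _)

∈-×[]⁻ : ∀ {𝔅 : Blocks n} u {B} → B List.∈ 𝔅 ×[ u ] → B List.∈ 𝔅
∈-×[]⁻ (suc zero) B∈ = B∈

×[]-unique : ∀ {𝔅 : Blocks n} u → Unique 𝔅 → Unique (𝔅 ×[ u ])
×[]-unique zero       _ = []
×[]-unique (suc zero) ! = !

degree-concatMap-×[] : ∀ (T : Subset n) (f : A → Blocks n) (u : A → Fin 2) xs {d : A → ℕ} →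
  (∀ {x} → x List.∈ xs → degree T (f x) ≡ d x) →
  ∑ (concatMap (λ x → f x ×[ u x ]) xs) (λ B → 𝟙 (T ⊆? B)) ≡ ∑ xs (λ x → toℕ (u x) * d x)
degree-concatMap-×[] T f u xs deg = trans (∑-concatMap _ xs _)
  (∑-cong {xs = xs} (λ {x} x∈xs → trans (sym (degree≡∑ T (f x ×[ u x ])))
    (trans (degree-×[] T (f x) (u x)) (cong (toℕ (u x) *_) (deg x∈xs)))))

-- Rounding loses at most one, which is less than the surplus of two gained when both r > s_i and t
-- - r > s_{k-i}.
t≤1+2⌊t/2⌋ : ∀ t → t ≤ suc (2 * ⌊ t /2⌋)
t≤1+2⌊t/2⌋ t = begin
  t                          ≡⟨ ⌊n/2⌋+⌈n/2⌉≡n t ⟨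
  ⌊ t /2⌋ + ⌊ suc t /2⌋      ≤⟨ +-monoʳ-≤ ⌊ t /2⌋ (⌊n/2⌋-mono (n≤1+n (suc t))) ⟩
  ⌊ t /2⌋ + suc ⌊ t /2⌋      ≡⟨ +-suc ⌊ t /2⌋ ⌊ t /2⌋ ⟩
  suc (⌊ t /2⌋ + ⌊ t /2⌋)    ≡⟨ cong (λ m → suc (⌊ t /2⌋ + m)) (+-identityʳ ⌊ t /2⌋) ⟨
  suc (2 * ⌊ t /2⌋)          ∎
  where open ≤-Reasoning

-- The construction

module Construction {v k t v₁ v₂ : ℕ} {C : Data v k} (H : Hypotheses C t v₁ v₂) where
  open Data C
  open Hypotheses H

  i≤k : ∀ (i : Fin (suc k)) → toℕ i ≤ k
  i≤k i = ≤-pred (toℕ<n i)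

  module D₁ (i : Fin (suc k)) = Component {v = v₁} (complete₁ (toℕ i)) (λ t<i → design₁ (toℕ i) t<i (i≤k i))
  module D₂ (i : Fin (suc k)) = Component {v = v₂} (complete₂ (co i)) (λ t<co → design₂ (co i) t<co (m∸n≤m k (toℕ i)))

  X₁#X₂ : ∀ {x} → x ∈ X₁ → x ∉ X₂
  X₁#X₂ {x} x∈X₁ x∈X₂ = ∉⊥ (subst (x ∈_) disjoint (x∈p∩q⁺ (x∈X₁ , x∈X₂)))

  open Joins cover X₁#X₂

  inR⇒∈R : ∀ {i} → i List.∈ inR → i ∈ R
  inR⇒∈R i∈ = proj₂ (∈-filter⁻ (_∈? R) {xs = allFin (suc k)} i∈)

  module _ (i : Fin (suc k)) where
    ∣B∩X₁∣ : ∀ {B} → B List.∈ 𝔅ᶠ i → ∣ B ∩ X₁ ∣ ≡ toℕ i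
    ∣B∩X₁∣ B∈ = D₁.block-size i (proj₁ (∈-join⁻ (D₁.on-points i) (D₂.on-points i) B∈))

    ∣B∣≡k : ∀ {B} → B List.∈ 𝔅ᶠ i → ∣ B ∣ ≡ k
    ∣B∣≡k {B} B∈ = begin
      ∣ B ∣                      ≡⟨ ∣∩∣+∣∩∣ B ⟨
      ∣ B ∩ X₁ ∣ + ∣ B ∩ X₂ ∣    ≡⟨ cong₂ _+_ (∣B∩X₁∣ B∈) (D₂.block-size i (proj₂ (∈-join⁻ (D₁.on-points i) (D₂.on-points i) B∈))) ⟩
      toℕ i + (k ∸ toℕ i)        ≡⟨ m+[n∸m]≡n (i≤k i) ⟩
      k                          ∎
      where open ≡-Reasoning

    𝔅ᶠ-unique : Unique (𝔅ᶠ i)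
    𝔅ᶠ-unique = join-unique (D₁.on-points i) (D₂.on-points i) (D₁.unique i) (D₂.unique i)

    module _ (i∈R : i ∈ R) where
      𝔄₁⊆X₁ : ∀ {h B} → B List.∈ 𝔄₁ i h → B ⊆ X₁
      𝔄₁⊆X₁ {h} = IsDesign.onPoints (class₁ i i∈R h)

      𝔄₂⊆X₂ : ∀ {j B} → B List.∈ 𝔄₂ i j → B ⊆ X₂
      𝔄₂⊆X₂ {j} = IsDesign.onPoints (class₂ i i∈R j)

      𝔅*⊆𝔅ᶠ : ∀ {B} → B List.∈ 𝔅* i → B List.∈ 𝔅ᶠ i
      𝔅*⊆𝔅ᶠ = circulant⊆join (toℕ (ε i)) (w i) (𝔄₁ i) (𝔄₂ i) 𝔄₁⊆X₁ 𝔄₂⊆X₂ (partition₁ i i∈R) (partition₂ i i∈R)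

      𝔅*-unique : Unique (𝔅* i)
      𝔅*-unique = circulant-unique (toℕ (ε i)) (w i) (𝔄₁ i) (𝔄₂ i) 𝔄₁⊆X₁ 𝔄₂⊆X₂
        (Unique-resp-↭ (↭-sym (partition₁ i i∈R)) (D₁.unique i))
        (Unique-resp-↭ (↭-sym (partition₂ i i∈R)) (D₂.unique i))

  module _ (T : Subset v) (∣T∣≡t : ∣ T ∣ ≡ t) where
    open ≡-Reasoning

    r r′ : ℕ
    r  = ∣ T ∩ X₁ ∣
    r′ = ∣ T ∩ X₂ ∣

    r+r′≡t : r + r′ ≡ t
    r+r′≡t = trans (∣∩∣+∣∩∣ T) ∣T∣≡t

    r≤t : r ≤ t
    r≤t = subst (r ≤_) r+r′≡t (m≤m+n r r′)

    r′≤t : r′ ≤ t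
    r′≤t = subst (r′ ≤_) r+r′≡t (m≤n+m r′ r)

    degree-D₁ : ∀ i → degree (T ∩ X₁) (D₁ (toℕ i)) ≡ λ₁ i r
    degree-D₁ i = D₁.lam-degree i r≤t (p∩q⊆q T X₁) refl

    degree-D₂ : ∀ i → degree (T ∩ X₂) (D₂ (co i)) ≡ λ₂ i r′
    degree-D₂ i = D₂.lam-degree i r′≤t (p∩q⊆q T X₂) refl

    degree-𝔅ᶠ : ∀ i → degree T (𝔅ᶠ i) ≡ λ₁ i r * λ₂ i r′
    degree-𝔅ᶠ i = trans (degree-join (D₁.on-points i) (D₂.on-points i) T) (cong₂ _*_ (degree-D₁ i) (degree-D₂ i))

    degree-𝔅* : ∀ {i} → i ∈ R → degree T (𝔅* i) ≡ Λ* i r r′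
    degree-𝔅* {i} i∈R = trans (degree-circulant (toℕ (ε i)) (w i) (𝔄₁ i) (𝔄₂ i) (𝔄₁⊆X₁ i i∈R) (𝔄₂⊆X₂ i i∈R) T)
      (go (N₁ i) (N₂ i) (sameNumber i i∈R) (𝔄₁ i) (𝔄₂ i) (partition₁ i i∈R) (partition₂ i i∈R)
          (class₁ i i∈R) (class₂ i i∈R) (w≤N/2 i i∈R))
      where
      T₁ = T ∩ X₁
      T₂ = T ∩ X₂
      -- N₁ i and N₂ i are generalised to variables, in order to match on their equality.
      go : ∀ N N′ → N ≡ N′ → (𝔄 : Fin N → Blocks v) (𝔄′ : Fin N′ → Blocks v) →
        IsPartitionOf 𝔄 (D₁ (toℕ i)) → IsPartitionOf 𝔄′ (D₂ (co i)) →
        (∀ h → IsDesign X₁ (𝔄 h) (s₁ i) v₁ (toℕ i) (lam* X₁ 𝔄 (s₁ i))) →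
        (∀ j → IsDesign X₂ (𝔄′ j) (s₂ i) v₂ (co i) (lam* X₂ 𝔄′ (s₂ i))) →
        w i ≤ ⌊ N /2⌋ →
        ∑ (allFin N) (λ h → ∑ (allFin N′) (λ j →
          𝟙 (within? (toℕ (ε i)) (w i) (dist N (toℕ h) (toℕ j))) * (degree T₁ (𝔄 h) * degree T₂ (𝔄′ j)))) ≡
        (if r ≤ᵇ s₁ i
         then (if r′ ≤ᵇ s₂ i
               then lam* X₁ 𝔄 r * lam* X₂ 𝔄′ r′ * N * circulantDegree N (toℕ (ε i)) (w i)
               else lam* X₁ 𝔄 r * λ₂ i r′ * circulantDegree N (toℕ (ε i)) (w i))
         else (if r′ ≤ᵇ s₂ i
               then λ₁ i r * lam* X₂ 𝔄′ r′ * circulantDegree N (toℕ (ε i)) (w i)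
               else 0))
      go N _ refl 𝔄 𝔄′ part₁ part₂ D D′ w≤ with r ≤? s₁ i | r′ ≤? s₂ i
      -- Both factors are constant here. Pulling out the left one leaves N equal terms on the right,
      -- the origin of the factor N in this case of `Λ*`.
      ... | yes r≤s₁ | yes r′≤s₂ = begin
        _ ≡⟨ ∑-circulant-constˡ (≤-pred (toℕ<n (ε i))) w≤ _ _ (classes-degree D r≤s₁ (p∩q⊆q T X₁) refl) ⟩
        lam* X₁ 𝔄 r * ∑ (allFin N) (λ j → degree T₂ (𝔄′ j)) * Z
          ≡⟨ cong (λ m → lam* X₁ 𝔄 r * m * Z) (begin
               ∑ (allFin N) (λ j → degree T₂ (𝔄′ j))
                 ≡⟨ ∑-cong {xs = allFin N} (λ {j} _ → classes-degree D′ r′≤s₂ (p∩q⊆q T X₂) refl j) ⟩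
               ∑ (allFin N) (λ _ → lam* X₂ 𝔄′ r′)
                 ≡⟨ ∑-const (allFin N) _ ⟩
               length (allFin N) * lam* X₂ 𝔄′ r′
                 ≡⟨ cong (_* lam* X₂ 𝔄′ r′) (length-tabulate {n = N} id) ⟩
               N * lam* X₂ 𝔄′ r′
                 ≡⟨ *-comm N _ ⟩
               lam* X₂ 𝔄′ r′ * N ∎) ⟩
        lam* X₁ 𝔄 r * (lam* X₂ 𝔄′ r′ * N) * Z
          ≡⟨ cong (_* Z) (*-assoc (lam* X₁ 𝔄 r) _ N) ⟨
        lam* X₁ 𝔄 r * lam* X₂ 𝔄′ r′ * N * Z
          ≡⟨ if-T (≤⇒≤ᵇ r′≤s₂) ⟨
        _ ≡⟨ if-T (≤⇒≤ᵇ r≤s₁) ⟨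
        _ ∎
        where Z = circulantDegree N (toℕ (ε i)) (w i)
      -- The degrees on the right may vary with the class; they are summed to a degree in the whole
      -- second design, so no factor N arises.
      ... | yes r≤s₁ | no r′≰s₂ = begin
        _ ≡⟨ ∑-circulant-constˡ (≤-pred (toℕ<n (ε i))) w≤ _ _ (classes-degree D r≤s₁ (p∩q⊆q T X₁) refl) ⟩
        lam* X₁ 𝔄 r * ∑ (allFin N) (λ j → degree T₂ (𝔄′ j)) * Z
          ≡⟨ cong (λ m → lam* X₁ 𝔄 r * m * Z) (trans (∑-degree-classes {𝔄 = 𝔄′} part₂) (degree-D₂ i)) ⟩
        lam* X₁ 𝔄 r * λ₂ i r′ * Z
          ≡⟨ if-F (r′≰s₂ ∘ ≤ᵇ⇒≤ r′ (s₂ i)) ⟨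
        _ ≡⟨ if-T (≤⇒≤ᵇ r≤s₁) ⟨
        _ ∎
        where Z = circulantDegree N (toℕ (ε i)) (w i)
      ... | no r≰s₁ | yes r′≤s₂ = begin
        _ ≡⟨ ∑-circulant-constʳ (≤-pred (toℕ<n (ε i))) w≤ _ _ (classes-degree D′ r′≤s₂ (p∩q⊆q T X₂) refl) ⟩
        ∑ (allFin N) (λ h → degree T₁ (𝔄 h)) * lam* X₂ 𝔄′ r′ * Z
          ≡⟨ cong (λ m → m * lam* X₂ 𝔄′ r′ * Z) (trans (∑-degree-classes {𝔄 = 𝔄} part₁) (degree-D₁ i)) ⟩
        λ₁ i r * lam* X₂ 𝔄′ r′ * Z
          ≡⟨ if-T (≤⇒≤ᵇ r′≤s₂) ⟨
        _ ≡⟨ if-F (r≰s₁ ∘ ≤ᵇ⇒≤ r (s₁ i)) ⟨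
        _ ∎
        where Z = circulantDegree N (toℕ (ε i)) (w i)
      -- Here t = r + r′ would be at least (s₁ + 1) + (s₂ + 1) ≥ 2⌊t/2⌋ + 2, which exceeds t.
      ... | no r≰s₁ | no r′≰s₂ = contradiction
        (≤-trans (+-mono-≤ (≰⇒> r≰s₁) (≰⇒> r′≰s₂)) (≤-trans (≤-reflexive r+r′≡t) (t≤1+2⌊t/2⌋ t)))
        (<⇒≱ (s≤s (≤-trans (s≤s (strengths i i∈R)) (≤-reflexive (sym (+-suc (s₁ i) (s₂ i)))))))

    degree-𝔅 : degree T 𝔅 ≡ L r (t ∸ r)
    degree-𝔅 = begin
      degree T 𝔅
        ≡⟨ degree≡∑ T 𝔅 ⟩
      ∑ 𝔅 (λ B → 𝟙 (T ⊆? B))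
        ≡⟨ ∑-++ (concatMap (λ i → 𝔅* i ×[ u i ]) inR) _ _ ⟩
      ∑ (concatMap (λ i → 𝔅* i ×[ u i ]) inR) (λ B → 𝟙 (T ⊆? B))
        + ∑ (concatMap (λ i → 𝔅ᶠ i ×[ u i ]) outsideR) (λ B → 𝟙 (T ⊆? B))
        ≡⟨ cong₂ _+_
             (degree-concatMap-×[] T 𝔅* u inR (λ i∈ → degree-𝔅* (inR⇒∈R i∈)))
             (degree-concatMap-×[] T 𝔅ᶠ u outsideR (λ {i} _ → degree-𝔅ᶠ i)) ⟩
      L r r′
        ≡⟨ cong (L r) (trans (sym (m+n∸m≡n r r′)) (cong (_∸ r) r+r′≡t)) ⟩
      L r (t ∸ r)
        ∎

  starred unstarred : Fin (suc k) → Blocks v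
  starred   i = 𝔅* i ×[ u i ]
  unstarred i = 𝔅ᶠ i ×[ u i ]

  outsideR⇒∉R : ∀ {i} → i List.∈ outsideR → i ∉ R
  outsideR⇒∉R i∈ = proj₂ (∈-filter⁻ (λ i → ¬? (i ∈? R)) {xs = allFin (suc k)} i∈)

  starred⊆𝔅ᶠ : ∀ {i B} → i List.∈ inR → B List.∈ starred i → B List.∈ 𝔅ᶠ i
  starred⊆𝔅ᶠ {i} i∈ B∈ = 𝔅*⊆𝔅ᶠ i (inR⇒∈R i∈) (∈-×[]⁻ (u i) B∈)

  -- Stated for full joins, it compares two starred blocks, two unstarred ones, or one of each.
  same-index : ∀ {i j B} → B List.∈ 𝔅ᶠ i → B List.∈ 𝔅ᶠ j → i ≡ j
  same-index {i} {j} B∈i B∈j = toℕ-injective (trans (sym (∣B∩X₁∣ i B∈i)) (∣B∩X₁∣ j B∈j))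

  ∈-starred⁻ : ∀ {B} → B List.∈ concatMap starred inR → ∃ λ i → i List.∈ inR × B List.∈ 𝔅ᶠ i
  ∈-starred⁻ B∈ = let i , i∈ , B∈i = List.find (∈-concatMap⁻ starred {xs = inR} B∈) in i , i∈ , starred⊆𝔅ᶠ i∈ B∈i

  ∈-unstarred⁻ : ∀ {B} → B List.∈ concatMap unstarred outsideR → ∃ λ i → i List.∈ outsideR × B List.∈ 𝔅ᶠ i
  ∈-unstarred⁻ B∈ =
    let i , i∈ , B∈i = List.find (∈-concatMap⁻ unstarred {xs = outsideR} B∈) in i , i∈ , ∈-×[]⁻ (u i) B∈i

  𝔅-blockSize : ∀ {B} → B List.∈ 𝔅 → ∣ B ∣ ≡ k
  𝔅-blockSize B∈ = [ (λ B∈s → let i , _ , B∈i = ∈-starred⁻ B∈s in ∣B∣≡k i B∈i)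
                   , (λ B∈u → let i , _ , B∈i = ∈-unstarred⁻ B∈u in ∣B∣≡k i B∈i)
                   ]′ (∈-++⁻ (concatMap starred inR) B∈)

  𝔅-unique : Unique 𝔅
  𝔅-unique = Unique.++⁺
    (Unique-concatMap⁺ (Unique.filter⁺ (_∈? R) (Unique.allFin⁺ (suc k)))
      (λ {i} i∈ → ×[]-unique (u i) (𝔅*-unique i (inR⇒∈R i∈)))
      (λ i∈ j∈ B∈i B∈j → same-index (starred⊆𝔅ᶠ i∈ B∈i) (starred⊆𝔅ᶠ j∈ B∈j)))
    (Unique-concatMap⁺ (Unique.filter⁺ (λ i → ¬? (i ∈? R)) (Unique.allFin⁺ (suc k)))
      (λ {i} _ → ×[]-unique (u i) (𝔅ᶠ-unique i))
      (λ {i} {j} _ _ B∈i B∈j → same-index (∈-×[]⁻ (u i) B∈i) (∈-×[]⁻ (u j) B∈j)))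
    -- A block in both lists would have a single index lying in R and outside R.
    (λ (B∈s , B∈u) →
      let i , i∈ , B∈i = ∈-starred⁻ B∈s
          j , j∈ , B∈j = ∈-unstarred⁻ B∈u
      in outsideR⇒∉R j∈ (subst (_∈ R) (same-index B∈i B∈j) (inR⇒∈R i∈)))

theorem3p1 : ∀ (v k t v₁ v₂ : ℕ) → v > k → k > t → t ≥ 2 →
    (C : Data v k) → Hypotheses C t v₁ v₂ →
    (Λ : ℕ) → Λ > 0 → (∀ r → r ≤ t → Data.L C r (t ∸ r) ≡ Λ) →
    IsSimpleDesign ⊤ (Data.𝔅 C) t v k Λ
theorem3p1 v k t v₁ v₂ v>k k>t t≥2 C H Λ Λ>0 L≡Λ = record
  { order     = ∣⊤∣≡n v
  ; strength  = <⇒≤ k>t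
  ; onPoints  = λ _ _ → ∈⊤
  ; blockSize = 𝔅-blockSize
  ; balanced  = λ T _ ∣T∣≡t → trans (degree-𝔅 T ∣T∣≡t) (L≡Λ _ (r≤t T ∣T∣≡t))
  } , 𝔅-unique
  where open Construction H
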